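{- Let $G$ be a connected graph with $\sigma_2\ge t_{k+1}-k+1$ and $k$ a positive integer. Then $G$ has a spanning $k$-ended tree.
   Context: All graphs are finite, undirected, without loops or multiple edges. For a graph $G$ with independence number $\alpha$: if $\alpha\ge 2$, $\sigma_2$ is the minimum degree sum $d(x)+d(y)$ over pairs of nonadjacent vertices $x,y$; otherwise $\sigma_2=+\infty$. A vertex of degree one of a tree is a leaf; a tree $T$ is $k$-ended if it has at most $k$ leaves. Each vertex and each edge is interpreted as a simple cycle of order 1 and 2, respectively; a Hamilton cycle is interpreted as a spanning 1-ended tree, and a Hamilton path is a spanning 2-ended tree. $t_k$ denotes the order (number of vertices) of a largest $k$-ended tree in $G$; in particular $t_1$ is the order of a longest cycle and $t_2$ is the order of a longest path in $G$. -}

module Defs where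

open import Data.Nat using (ℕ; zero; suc; _+_; _≤_; _≡ᵇ_)
open import Data.Bool using (Bool; true; false; _∧_; if_then_else_)
open import Data.Fin using (Fin; _≟_)
open import Data.List using (List; []; _∷_; length; map; allFin; head; last)
open import Data.Nat.ListAction using (sum)
open import Data.Bool.ListAction using (any)
open import Data.List.Relation.Unary.Unique.Propositional using (Unique)
open import Data.Maybe using (just)
open import Data.Product using (Σ; _×_; ∃)
open import Relation.Nullary using (¬_; ⌊_⌋)
open import Relation.Binary.PropositionalEquality using (_≡_)

record Graph (n : ℕ) : Set where
  field
    adj    : Fin n → Fin n → Bool
    sym    : ∀ x y → adj x y ≡ adj y x
    irrefl : ∀ x → adj x x ≡ false
open Graph public

countTrue : ∀ {n} → (Fin n → Bool) → ℕ
countTrue {n} P = sum (map (λ y → if P y then 1 else 0) (allFin n))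

degR : ∀ {n} → (Fin n → Fin n → Bool) → Fin n → ℕ
degR R x = countTrue (λ y → R x y)

deg : ∀ {n} → Graph n → Fin n → ℕ
deg G x = degR (adj G) x

data Chain {n} (R : Fin n → Fin n → Bool) : List (Fin n) → Set where
  nil  : Chain R []
  one  : ∀ x → Chain R (x ∷ [])
  step : ∀ {x y xs} → R x y ≡ true → Chain R (y ∷ xs) → Chain R (x ∷ y ∷ xs)

ConnectedOn : ∀ {n} → (Fin n → Bool) → (Fin n → Fin n → Bool) → Set
ConnectedOn V R = ∀ u v → V u ≡ true → V v ≡ true →
  Σ (List _) λ p → Chain R p × head p ≡ just u × last p ≡ just v

Connected : ∀ {n} → Graph n → Set
Connected G = ConnectedOn (λ _ → true) (adj G)

record CycleIn {n} (R : Fin n → Fin n → Bool) : Set where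
  field
    cverts   : List (Fin n)
    cdistinct : Unique cverts
    clong    : 3 ≤ length cverts
    cchain   : Chain R cverts
    cclosed  : ∀ x y → head cverts ≡ just x → last cverts ≡ just y → R y x ≡ true

record Tree {n} (G : Graph n) : Set where
  field
    inV     : Fin n → Bool
    inE     : Fin n → Fin n → Bool
    E-sym   : ∀ x y → inE x y ≡ inE y x
    E⊆G     : ∀ x y → inE x y ≡ true → adj G x y ≡ true
    E⊆V     : ∀ x y → inE x y ≡ true → inV x ≡ true
    nonempty : ∃ λ x → inV x ≡ true
    connected : ConnectedOn inV inE
    acyclic : ¬ CycleIn inE
open Tree public

leaves : ∀ {n} {G : Graph n} → Tree G → ℕ
leaves T = countTrue (λ x → inV T x ∧ (degR (inE T) x ≡ᵇ 1))

-- a cycle of G under the conventions: a vertex (order 1), an edge (order 2),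
-- or a simple cycle of order ≥ 3
record GCycle {n} (G : Graph n) : Set where
  field
    verts    : List (Fin n)
    distinct : Unique verts
    nonempty : 1 ≤ length verts
    chain    : Chain (adj G) verts
    closed   : 3 ≤ length verts →
               ∀ x y → head verts ≡ just x → last verts ≡ just y → adj G y x ≡ true
open GCycle public

-- k-ended trees: for k = 1 these are cycles (conventions above);
-- for k ≥ 2 trees with at most k leaves. (k = 0 is never used.)
data KEnded {n} (G : Graph n) : ℕ → Set where
  cyc  : GCycle G → KEnded G 1
  tree : ∀ {k} → (T : Tree G) → leaves T ≤ suc (suc k) → KEnded G (suc (suc k))

vertsOf : ∀ {n} {G : Graph n} {k} → KEnded G k → Fin n → Bool
vertsOf (cyc C)    v = any (λ u → ⌊ u ≟ v ⌋) (verts C)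
vertsOf (tree T _) v = inV T v

order : ∀ {n} {G : Graph n} {k} → KEnded G k → ℕ
order T = countTrue (vertsOf T)

Spanning : ∀ {n} {G : Graph n} {k} → KEnded G k → Set
Spanning T = ∀ v → vertsOf T v ≡ true

IsT : ∀ {n} → Graph n → ℕ → ℕ → Set
IsT G k t = (Σ (KEnded G k) λ T → order T ≡ t) × (∀ (T : KEnded G k) → order T ≤ t)

-- k = 1 is Ore's argument: a path that cannot be prolonged at its ends closes up, after at
-- most one crossing exchange, to a cycle on its vertices, and by connectedness a cycle that
-- misses a vertex gives a longer path. Paths are trees with at most 2 leaves, hence have at
-- most t vertices.
--
-- For k ≥ 2 let T be a largest tree with at most k + 1 leaves. If T has at most k leaves it
-- spans, since otherwise a pendant vertex could be added. Otherwise the neighbours of its leaves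
-- lie in T. If two leaves are adjacent, adding the edge between them and deleting an edge of the
-- cycle at a branch vertex loses a leaf. If not, take leaves x ≠ y, root T at x, and for v ∈ N(x)
-- move the edge from v to its parent w over to vx. This loses a leaf if w ≠ x has degree at
-- least 3, and otherwise makes w a leaf; if w is adjacent to y, the previous case applies.
-- If no leaf is ever lost, v ↦ w is injective on N(x) and misses N(y) and all leaves but x, so that
-- d(x) + d(y) + k ≤ t, contrary to the hypothesis.
module Submission where

open import Defs
open import Data.Nat using (ℕ; zero; suc; _+_; _≤_; _<_; z≤n; s≤s; _≡ᵇ_; _≤?_)
open import Data.Nat.Properties using (module ≤-Reasoning; +-commutativeSemigroup; +-mono-≤; +-monoʳ-≤; +-assoc; +-comm; +-suc; m≤m+n; ≤-refl; ≤-reflexive; ≤-trans; ≤-pred; <-trans; <-irrefl; <-asym; <⇒≤; n≤1+n; m≤n+m; ≰⇒>; suc-injective; ≡ᵇ⇒≡)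
open import Data.Bool using (Bool; true; false; _∧_; if_then_else_)
open import Data.Bool.Properties using (T-≡; ∨-zeroʳ) renaming (_≟_ to _≟ᵇ_)
open import Data.Fin using (Fin; zero; suc; _≟_)
open import Data.Fin.Properties using (any?) renaming (suc-injective to Fin-suc-injective)
open import Data.List using (List; []; _∷_; _++_; length; head; last; reverse)
open import Data.List.Properties using (map-tabulate; length-reverse; unfold-reverse)
open import Data.List.Membership.Propositional using (_∈_; _∉_)
open import Data.List.Relation.Unary.Any using (here; there)
open import Data.List.Relation.Unary.All using (All; []; _∷_)
open import Data.List.Relation.Unary.AllPairs using ([]; _∷_)
open import Data.List.Relation.Unary.Unique.Propositional using (Unique)
open import Data.Maybe using (just)
open import Data.Maybe.Properties using (just-injective)
open import Data.Nat.ListAction using (sum)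
open import Data.Product using (Σ; ∃; _×_; _,_; proj₁; proj₂)
open import Data.Sum using (_⊎_; inj₁; inj₂)
import Data.Sum as Sum
open import Data.Bool.ListAction using (any)
open import Data.List.Relation.Binary.Permutation.Propositional using (_↭_; ↭-refl; ↭-sym; ↭⇒↭ₛ)
open import Data.List.Relation.Binary.Permutation.Propositional.Properties using (↭-length; ↭-reverse; ++⁺ˡ; ++-comm; ∈-resp-↭)
open import Data.List.Relation.Binary.Permutation.Setoid.Properties using (Unique-resp-↭)
open import Data.Nat.Tactic.RingSolver using (solve-∀)
import Data.List.Relation.Unary.All as All
import Data.List.Relation.Unary.Any as Any
open import Data.List.Relation.Unary.All.Properties using (¬Any⇒All¬)
open import Data.Empty using (⊥; ⊥-elim)
open import Data.Vec.Functional using (updateAt)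
open import Data.Vec.Functional.Properties using (updateAt-updates; updateAt-minimal)
open import Algebra.Properties.CommutativeSemigroup +-commutativeSemigroup using (interchange)
open import Function using (_∘_; const; Equivalence)
open import Relation.Nullary using (⌊_⌋; ¬_; Dec; yes; no; does; contradiction; ¬?; _×-dec_; _⊎-dec_)
open import Relation.Nullary.Decidable using (dec-true; decidable-stable; isYes≗does)
open import Relation.Binary.PropositionalEquality as ≡ using (_≡_; _≢_; refl; cong; cong₂; trans; subst; ≢-sym)

private
  variable
    m n : ℕ

-- Booleans and decisions

does⁻ : {A : Set} (a? : Dec A) → does a? ≡ true → A
does⁻ (yes a) _ = a

≢true⇒≡false : {b : Bool} → b ≢ true → b ≡ false
≢true⇒≡false {false} _   = refl
≢true⇒≡false {true}  b≢t = contradiction refl b≢t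

true≢false : {b : Bool} → b ≡ true → b ≢ false
true≢false refl ()

≡true-ext : {b c : Bool} → (b ≡ true → c ≡ true) → (c ≡ true → b ≡ true) → b ≡ c
≡true-ext {false} {false} _ _ = refl
≡true-ext {false} {true}  _ g = g refl
≡true-ext {true}          f _ = ≡.sym (f refl)

-- Counting

_⊆_ : (P Q : Fin n → Bool) → Set
P ⊆ Q = ∀ x → P x ≡ true → Q x ≡ true

infix 4 _⊆_
infixl 6 _∖_

_∖_ : (Fin n → Bool) → Fin n → Fin n → Bool
P ∖ a = updateAt P a (const false)

∖-at : (P : Fin n → Bool) (a : Fin n) → (P ∖ a) a ≡ false
∖-at P a = updateAt-updates a P

∖-other : (P : Fin n → Bool) {a x : Fin n} → x ≢ a → (P ∖ a) x ≡ P x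
∖-other P {a} {x} x≢a = updateAt-minimal x a P x≢a

∖⁻ : (P : Fin n → Bool) {a x : Fin n} → (P ∖ a) x ≡ true → P x ≡ true × x ≢ a
∖⁻ P {a} {x} h with x ≟ a
... | yes refl = contradiction (∖-at P a) (true≢false h)
... | no x≢a   = trans (≡.sym (∖-other P x≢a)) h , x≢a

∖⁺ : (P : Fin n → Bool) {a x : Fin n} → P x ≡ true → x ≢ a → (P ∖ a) x ≡ true
∖⁺ P h x≢a = trans (∖-other P x≢a) h

indicator : Bool → ℕ
indicator b = if b then 1 else 0

countTrue-suc : (P : Fin (suc n) → Bool) → countTrue P ≡ indicator (P zero) + countTrue (P ∘ suc)
countTrue-suc P = cong (λ l → indicator (P zero) + sum l)
  (trans (map-tabulate suc (indicator ∘ P)) (≡.sym (map-tabulate (λ x → x) (indicator ∘ P ∘ suc))))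

countTrue-cong : {P Q : Fin n → Bool} → (∀ x → P x ≡ Q x) → countTrue P ≡ countTrue Q
countTrue-cong {zero}  _ = refl
countTrue-cong {suc n} {P} {Q} h = begin
  countTrue P                                ≡⟨ countTrue-suc P ⟩
  indicator (P zero) + countTrue (P ∘ suc)   ≡⟨ cong₂ (λ b c → indicator b + c) (h zero) (countTrue-cong (h ∘ suc)) ⟩
  indicator (Q zero) + countTrue (Q ∘ suc)   ≡⟨ countTrue-suc Q ⟨
  countTrue Q                                ∎
  where open ≡.≡-Reasoning

indicator-mono : {b c : Bool} → (b ≡ true → c ≡ true) → indicator b ≤ indicator c
indicator-mono {false} _ = z≤n
indicator-mono {true}  h rewrite h refl = ≤-refl

countTrue-mono : {P Q : Fin n → Bool} → P ⊆ Q → countTrue P ≤ countTrue Q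
countTrue-mono {zero}  _ = z≤n
countTrue-mono {suc n} {P} {Q} h rewrite countTrue-suc P | countTrue-suc Q =
  +-mono-≤ (indicator-mono (h zero)) (countTrue-mono (h ∘ suc))

-- Adding or deleting an edge flips one entry in a row of the edge predicate; the degree changes
-- below are computed through this.
countTrue-flip : {P Q : Fin n → Bool} (a : Fin n) → P a ≡ true → Q a ≡ false →
                 (∀ x → x ≢ a → P x ≡ Q x) → countTrue P ≡ suc (countTrue Q)
countTrue-flip {P = P} {Q} zero Pa Qa h
  rewrite countTrue-suc P | countTrue-suc Q | Pa | Qa =
  cong suc (countTrue-cong (λ x → h (suc x) λ ()))
countTrue-flip {P = P} {Q} (suc a) Pa Qa h
  rewrite countTrue-suc P | countTrue-suc Q | h zero (λ ()) =
  trans (cong (indicator (Q zero) +_)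
          (countTrue-flip a Pa Qa (λ x x≢a → h (suc x) (x≢a ∘ Fin-suc-injective))))
        (+-suc _ _)

countTrue-∖ : (P : Fin n → Bool) {a : Fin n} → P a ≡ true → countTrue P ≡ suc (countTrue (P ∖ a))
countTrue-∖ P {a} Pa = countTrue-flip a Pa (∖-at P a) (λ x x≢a → ≡.sym (∖-other P x≢a))

countTrue-⊆-suc : {P Q : Fin n → Bool} (a : Fin n) → (∀ x → P x ≡ true → x ≡ a ⊎ Q x ≡ true) →
                  countTrue P ≤ suc (countTrue Q)
countTrue-⊆-suc {P = P} {Q} a h with P a ≟ᵇ true
... | yes Pa = ≤-trans (≤-reflexive (countTrue-∖ P Pa)) (s≤s (countTrue-mono P∖a⊆Q))
  where
  P∖a⊆Q : P ∖ a ⊆ Q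
  P∖a⊆Q x Px with ∖⁻ P Px
  ... | Px , x≢a with h x Px
  ... | inj₁ x≡a = contradiction x≡a x≢a
  ... | inj₂ Qx  = Qx
... | no ¬Pa = ≤-trans (countTrue-mono P⊆Q) (n≤1+n _)
  where
  P⊆Q : P ⊆ Q
  P⊆Q x Px with h x Px
  ... | inj₁ refl = contradiction Px ¬Pa
  ... | inj₂ Qx   = Qx

countTrue-none : {P : Fin n → Bool} → (∀ x → P x ≢ true) → countTrue P ≡ 0
countTrue-none {zero}  _ = refl
countTrue-none {suc n} {P} h rewrite countTrue-suc P | ≢true⇒≡false (h zero) = countTrue-none (h ∘ suc)

countTrue-positive : (P : Fin n → Bool) → 1 ≤ countTrue P → ∃ λ x → P x ≡ true
countTrue-positive P 1≤ with any? (λ x → P x ≟ᵇ true)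
... | yes found = found
... | no ¬found = contradiction (≤-trans 1≤ (≤-reflexive (countTrue-none (λ x Px → ¬found (x , Px))))) λ ()

-- Induction on the domain: the image of `zero` is deleted from `C`, and injectivity keeps the other
-- images off it.
countTrue-inj : {A : Fin m → Bool} {C : Fin n → Bool} (f : Fin m → Fin n) →
                (∀ x → A x ≡ true → C (f x) ≡ true) →
                (∀ x y → A x ≡ true → A y ≡ true → f x ≡ f y → x ≡ y) →
                countTrue A ≤ countTrue C
countTrue-inj {zero}  f _ _ = z≤n
countTrue-inj {suc m} {A = A} {C} f into inj rewrite countTrue-suc A with A zero in A0
... | false = countTrue-inj (f ∘ suc) (into ∘ suc) (λ x y Ax Ay e → Fin-suc-injective (inj (suc x) (suc y) Ax Ay e))
... | true rewrite countTrue-∖ C (into zero A0) =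
  s≤s (countTrue-inj (f ∘ suc)
        (λ x Ax → ∖⁺ C (into (suc x) Ax) (λ e → contradiction (inj (suc x) zero Ax A0 e) λ ()))
        (λ x y Ax Ay e → Fin-suc-injective (inj (suc x) (suc y) Ax Ay e)))

indicator-disjoint : {p q s : Bool} → (p ≡ true → s ≡ true) → (q ≡ true → s ≡ true) →
                     (p ≡ true → q ≢ true) → indicator p + indicator q ≤ indicator s
indicator-disjoint {false} _ q⇒s _ = indicator-mono q⇒s
indicator-disjoint {true} {false} p⇒s _ _ = indicator-mono p⇒s
indicator-disjoint {true} {true} _ _ disj = contradiction refl (disj refl)

countTrue-disjoint : {P Q S : Fin n → Bool} → P ⊆ S → Q ⊆ S → (∀ x → P x ≡ true → Q x ≢ true) →
                     countTrue P + countTrue Q ≤ countTrue S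
countTrue-disjoint {zero} _ _ _ = z≤n
countTrue-disjoint {suc n} {P} {Q} {S} P⊆S Q⊆S disj
  rewrite countTrue-suc P | countTrue-suc Q | countTrue-suc S
        | interchange (indicator (P zero)) (countTrue (P ∘ suc)) (indicator (Q zero)) (countTrue (Q ∘ suc)) =
  +-mono-≤ (indicator-disjoint (P⊆S zero) (Q⊆S zero) (disj zero))
           (countTrue-disjoint (P⊆S ∘ suc) (Q⊆S ∘ suc) (disj ∘ suc))

-- Leaves

Leaf : (V : Fin n → Bool) (E : Fin n → Fin n → Bool) → Fin n → Set
Leaf V E x = V x ≡ true × degR E x ≡ 1

isLeaf : (V : Fin n → Bool) (E : Fin n → Fin n → Bool) → Fin n → Bool
isLeaf V E x = V x ∧ (degR E x ≡ᵇ 1)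

isLeaf⁻ : (V : Fin n → Bool) (E : Fin n → Fin n → Bool) {x : Fin n} → isLeaf V E x ≡ true → Leaf V E x
isLeaf⁻ V E {x} h with V x
... | true = refl , ≡ᵇ⇒≡ _ _ (Equivalence.from T-≡ h)

isLeaf⁺ : (V : Fin n → Bool) (E : Fin n → Fin n → Bool) {x : Fin n} → Leaf V E x → isLeaf V E x ≡ true
isLeaf⁺ V E (Vx , d) rewrite Vx | d = refl

leafCount : (V : Fin n → Bool) (E : Fin n → Fin n → Bool) → ℕ
leafCount V E = countTrue (isLeaf V E)

module _ {V V′ : Fin n → Bool} {E E′ : Fin n → Fin n → Bool} where

  -- Tree surgery below has one of three effects: a leaf is lost, a leaf is traded for at most one
  -- other, or at most one is gained. Only upper bounds are wanted, so it suffices to locate the new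
  -- leaves among the old.
  leafCount-drop : ∀ u → Leaf V E u → (∀ x → Leaf V′ E′ x → Leaf V E x × x ≢ u) →
                   leafCount V′ E′ < leafCount V E
  leafCount-drop u lu h rewrite countTrue-∖ (isLeaf V E) (isLeaf⁺ V E lu) =
    s≤s (countTrue-mono λ x l → let lx , x≢u = h x (isLeaf⁻ V′ E′ l) in
                                ∖⁺ (isLeaf V E) (isLeaf⁺ V E lx) x≢u)

  leafCount-swap : ∀ u w → Leaf V E u → (∀ x → Leaf V′ E′ x → x ≡ w ⊎ (Leaf V E x × x ≢ u)) →
                   leafCount V′ E′ ≤ leafCount V E
  leafCount-swap u w lu h rewrite countTrue-∖ (isLeaf V E) (isLeaf⁺ V E lu) =
    countTrue-⊆-suc w λ x l → Sum.map₂ (λ (lx , x≢u) → ∖⁺ (isLeaf V E) (isLeaf⁺ V E lx) x≢u)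
                                       (h x (isLeaf⁻ V′ E′ l))

  leafCount-gain : ∀ w → (∀ x → Leaf V′ E′ x → x ≡ w ⊎ Leaf V E x) →
                   leafCount V′ E′ ≤ suc (leafCount V E)
  leafCount-gain w h =
    countTrue-⊆-suc w λ x l → Sum.map₂ (isLeaf⁺ V E) (h x (isLeaf⁻ V′ E′ l))

leafCount-cong : {V V′ : Fin n → Bool} {E E′ : Fin n → Fin n → Bool} →
                 (∀ x → V x ≡ V′ x) → (∀ x y → E x y ≡ E′ x y) → leafCount V E ≡ leafCount V′ E′
leafCount-cong V≗V′ E≗E′ =
  countTrue-cong λ x → cong₂ (λ b d → b ∧ (d ≡ᵇ 1)) (V≗V′ x) (countTrue-cong (E≗E′ x))

-- Deleting `x` and then `y` from the set of leaves costs at most two, also when they coincide;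
-- `reduce` uses the case `x` = `y`.
leafCount-third : (V : Fin n → Bool) (E : Fin n → Fin n → Bool) → 3 ≤ leafCount V E →
                  ∀ x y → ∃ λ z → Leaf V E z × z ≢ x × z ≢ y
leafCount-third V E 3≤ x y =
  let L = isLeaf V E
      drop : ∀ (P : Fin _ → Bool) a → countTrue P ≤ suc (countTrue (P ∖ a))
      drop P a = countTrue-⊆-suc a λ z Pz → split P a z Pz
      z , Pz = countTrue-positive (L ∖ x ∖ y)
                 (≤-pred (≤-pred (≤-trans 3≤ (≤-trans (drop L x) (s≤s (drop (L ∖ x) y))))))
      Pz′ , z≢y = ∖⁻ (L ∖ x) Pz
      Lz , z≢x = ∖⁻ L Pz′
  in z , isLeaf⁻ V E Lz , z≢x , z≢y
  where
  split : ∀ (P : Fin _ → Bool) a z → P z ≡ true → z ≡ a ⊎ (P ∖ a) z ≡ true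
  split P a z Pz with z ≟ a
  ... | yes z≡a = inj₁ z≡a
  ... | no z≢a  = inj₂ (∖⁺ P Pz z≢a)

degR-zero : (E : Fin n → Fin n → Bool) {a b : Fin n} → degR E a ≡ 0 → E a b ≢ true
degR-zero E {a} d0 ab = contradiction (trans (≡.sym d0) (countTrue-∖ (E a) ab)) λ ()

module _ (E : Fin n → Fin n → Bool) {a b c : Fin n} (ab : E a b ≡ true) where

  degR-≥2 : E a c ≡ true → c ≢ b → ∃ λ d → degR E a ≡ suc (suc d)
  degR-≥2 ac c≢b = _ , trans (countTrue-∖ (E a) ab) (cong suc (countTrue-∖ (E a ∖ b) (∖⁺ (E a) ac c≢b)))

  degR-≥3 : ∀ {d} → E a c ≡ true → c ≢ b → E a d ≡ true → d ≢ b → d ≢ c → 3 ≤ degR E a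
  degR-≥3 ac c≢b ad d≢b d≢c
    rewrite countTrue-∖ (E a) ab
          | countTrue-∖ (E a ∖ b) (∖⁺ (E a) ac c≢b)
          | countTrue-∖ (E a ∖ b ∖ c) (∖⁺ (E a ∖ b) (∖⁺ (E a) ad d≢b) d≢c) = s≤s (s≤s (s≤s z≤n))

  degR-1-unique : degR E a ≡ 1 → E a c ≡ true → c ≡ b
  degR-1-unique d1 ac with c ≟ b
  ... | yes c≡b = c≡b
  ... | no c≢b = contradiction (trans (≡.sym d1) (proj₂ (degR-≥2 ac c≢b))) λ ()

-- Walks

-- Chains with their ends in the type, so that concatenation and reversal track the ends while the
-- vertex list stays explicit.
data Walk {n} (R : Fin n → Fin n → Bool) : Fin n → Fin n → List (Fin n) → Set where
  stop : ∀ x → Walk R x x (x ∷ [])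
  _◂_  : ∀ {x y z l} → R x y ≡ true → Walk R y z l → Walk R x z (x ∷ l)

infixr 5 _◂_

Linked : (R : Fin n → Fin n → Bool) → Fin n → Fin n → Set
Linked R x y = ∃ (Walk R x y)

module _ {R : Fin n → Fin n → Bool} where

  walk-chain : ∀ {x y l} → Walk R x y l → Chain R l
  walk-chain (stop x)       = one x
  walk-chain (e ◂ stop y)   = step e (one y)
  walk-chain (e ◂ e′ ◂ w)   = step e (walk-chain (e′ ◂ w))

  walk-head : ∀ {x y l} → Walk R x y l → head l ≡ just x
  walk-head (stop x) = refl
  walk-head (_ ◂ _)  = refl

  walk-last : ∀ {x y l} → Walk R x y l → last l ≡ just y
  walk-last (stop x)     = refl
  walk-last (_ ◂ stop y) = refl
  walk-last (_ ◂ e ◂ w)  = walk-last (e ◂ w)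

  chain-walk : ∀ {x y l} → Chain R l → head l ≡ just x → last l ≡ just y → Walk R x y l
  chain-walk (one x)    refl refl = stop x
  chain-walk (step e c) refl h    = e ◂ chain-walk c refl h

  start∈ : ∀ {x y l} → Walk R x y l → x ∈ l
  start∈ (stop x) = here refl
  start∈ (_ ◂ _)  = here refl

  end∈ : ∀ {x y l} → Walk R x y l → y ∈ l
  end∈ (stop x) = here refl
  end∈ (_ ◂ w)  = there (end∈ w)

  walk-++ : ∀ {x y y′ z l l′} → Walk R x y l → R y y′ ≡ true → Walk R y′ z l′ → Walk R x z (l ++ l′)
  walk-++ (stop x) e w′ = e ◂ w′
  walk-++ (e′ ◂ w) e w′ = e′ ◂ walk-++ w e w′

  walk-reverse : (∀ x y → R x y ≡ R y x) → ∀ {x y l} → Walk R x y l → Walk R y x (reverse l)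
  walk-reverse sy (stop x) = stop x
  walk-reverse sy (_◂_ {x} {y} {l = l} e w) rewrite unfold-reverse x l =
    walk-++ (walk-reverse sy w) (trans (sy y x) e) (stop x)

  linked-trans : ∀ {x y z} → Linked R x y → Linked R y z → Linked R x z
  linked-trans (_ , stop x) w′ = w′
  linked-trans (_ , e ◂ w)  w′ = _ , e ◂ proj₂ (linked-trans (_ , w) w′)

  -- This is how connectedness enters: it supplies an edge leaving the current tree or cycle.
  crossing : (P : Fin n → Bool) → ∀ {x y l} → Walk R x y l → P x ≡ true → P y ≢ true →
             ∃ λ a → ∃ λ b → P a ≡ true × P b ≢ true × R a b ≡ true
  crossing P (stop x) Px ¬Px = contradiction Px ¬Px
  crossing P (_◂_ {x} {y} e w) Px ¬Pz with P y ≟ᵇ true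
  ... | yes Py = crossing P w Py ¬Pz
  ... | no ¬Py = x , y , Px , ¬Py , e

  suffix : ∀ {x y u l} → Walk R x y l → Unique l → u ∈ l →
           ∃ λ l′ → Walk R u y l′ × Unique l′
  suffix w@(stop x) uq (here refl)       = _ , w , uq
  suffix w@(_ ◂ _)  uq (here refl)       = _ , w , uq
  suffix (_ ◂ w)    (_ ∷ uq) (there u∈l) = suffix w uq u∈l

  -- If the new first vertex recurs on the loop-free remainder, the walk is restarted at that
  -- occurrence.
  loop-erase : ∀ {x y l} → Walk R x y l → ∃ λ l′ → Walk R x y l′ × Unique l′
  loop-erase (stop x) = _ , stop x , [] ∷ []
  loop-erase (_◂_ {x} e w) with loop-erase w
  ... | l , w′ , uq with Any.any? (x ≟_) l
  ...   | yes x∈l = suffix w′ uq x∈l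
  ...   | no  x∉l = x ∷ l , e ◂ w′ , ¬Any⇒All¬ l x∉l ∷ uq

walk-map : {R S : Fin n → Fin n → Bool} → (∀ x y → R x y ≡ true → S x y ≡ true) →
           ∀ {x y l} → Walk R x y l → Walk S x y l
walk-map f (stop x) = stop x
walk-map f (e ◂ w)  = f _ _ e ◂ walk-map f w

connectedOn-linked : {V : Fin n → Bool} {R : Fin n → Fin n → Bool} → ConnectedOn V R →
                     ∀ {u v} → V u ≡ true → V v ≡ true → Linked R u v
connectedOn-linked con Vu Vv with con _ _ Vu Vv
... | p , ch , hd , ls = p , chain-walk ch hd ls

-- Rooted trees

module _ (r : Fin n) (par : Fin n → Fin n) where

  -- Reaching `r` in `d` parent steps excludes cycles of `par` and gives a recursion argument for
  -- inductions towards the root. The condition `v ≢ r` makes `d` unique.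
  data Above : ℕ → Fin n → Set where
    top : Above zero r
    hop : ∀ {d v} → v ≢ r → Above d (par v) → Above (suc d) v

  Above-unique : ∀ {d e v} → Above d v → Above e v → d ≡ e
  Above-unique top       top       = refl
  Above-unique top       (hop v≢r _) = contradiction refl v≢r
  Above-unique (hop v≢r _) top       = contradiction refl v≢r
  Above-unique (hop _ a) (hop _ b) = cong suc (Above-unique a b)

-- Trees are handled through a parent function, since attaching a vertex or moving an edge then
-- changes a single value of `par`. Connectedness and acyclicity both come from `above`.
record Rooted (n : ℕ) : Set where
  field
    mem   : Fin n → Bool
    root  : Fin n
    par   : Fin n → Fin n
    root∈ : mem root ≡ true
    par∈  : ∀ {v} → mem v ≡ true → v ≢ root → mem (par v) ≡ true
    above : ∀ {v} → mem v ≡ true → ∃ λ d → Above root par d v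

  Child : Fin n → Fin n → Set
  Child u v = mem v ≡ true × v ≢ root × par v ≡ u

  child? : ∀ u v → Dec (Child u v)
  child? u v = (mem v ≟ᵇ true) ×-dec ¬? (v ≟ root) ×-dec (par v ≟ u)

  edge? : ∀ u v → Dec (Child u v ⊎ Child v u)
  edge? u v = child? u v ⊎-dec child? v u

  -- Abstract, so that case analysis on vertices leaves edge and degree terms alone.
  abstract
    edge : Fin n → Fin n → Bool
    edge u v = does (edge? u v)

    edge⁻ : ∀ {u v} → edge u v ≡ true → Child u v ⊎ Child v u
    edge⁻ = does⁻ (edge? _ _)

    edge⁺ : ∀ {u v} → Child u v ⊎ Child v u → edge u v ≡ true
    edge⁺ = dec-true (edge? _ _)

  edge-false : ∀ {u v} → ¬ Child u v → ¬ Child v u → edge u v ≡ false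
  edge-false ¬uv ¬vu = ≢true⇒≡false λ e → Sum.[ ¬uv , ¬vu ] (edge⁻ e)

  edge-sym : ∀ u v → edge u v ≡ edge v u
  edge-sym u v = ≡true-ext (edge⁺ ∘ Sum.swap ∘ edge⁻) (edge⁺ ∘ Sum.swap ∘ edge⁻)

  parent-edge : ∀ {v} → mem v ≡ true → v ≢ root → edge v (par v) ≡ true
  parent-edge v∈ v≢r = edge⁺ (inj₂ (v∈ , v≢r , refl))

  child-edge : ∀ {v} → mem v ≡ true → v ≢ root → edge (par v) v ≡ true
  child-edge v∈ v≢r = edge⁺ (inj₁ (v∈ , v≢r , refl))

  child-parent∈ : ∀ {u v} → Child u v → mem u ≡ true
  child-parent∈ (v∈ , v≢r , refl) = par∈ v∈ v≢r

  edge⇒mem : ∀ {u v} → edge u v ≡ true → mem u ≡ true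
  edge⇒mem e with edge⁻ e
  ... | inj₁ c = child-parent∈ c
  ... | inj₂ c = proj₁ c

  depth : Fin n → ℕ
  depth v with mem v ≟ᵇ true
  ... | yes v∈ = proj₁ (above v∈)
  -- A default off the tree; `depth-above` and `child-depth` speak of members only.
  ... | no _   = 0

  depth-above : ∀ {v} → mem v ≡ true → Above root par (depth v) v
  depth-above {v} v∈ with mem v ≟ᵇ true
  ... | yes v∈′ = proj₂ (above v∈′)
  ... | no v∉   = contradiction v∈ v∉

  child-depth : ∀ {u v} → Child u v → depth u < depth v
  child-depth {v = v} (v∈ , v≢r , refl) =
    ≤-reflexive (Above-unique root par (hop v≢r (depth-above (par∈ v∈ v≢r))) (depth-above v∈))

  ¬self-child : ∀ {v} → ¬ Child v v
  ¬self-child c = <-irrefl refl (child-depth c)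

  ¬mutual-child : ∀ {u v} → Child u v → ¬ Child v u
  ¬mutual-child c c′ = <-asym (child-depth c) (child-depth c′)

  climb : ∀ {d v} → mem v ≡ true → Above root par d v → Linked edge v root
  climb v∈ top         = _ , stop root
  climb v∈ (hop v≢r a) = _ , parent-edge v∈ v≢r ◂ proj₂ (climb (par∈ v∈ v≢r) a)

  edge-linked : ∀ {u v} → mem u ≡ true → mem v ≡ true → Linked edge u v
  edge-linked u∈ v∈ =
    linked-trans (climb u∈ (depth-above u∈)) (_ , walk-reverse edge-sym (proj₂ (climb v∈ (depth-above v∈))))

  edge-connected : ConnectedOn mem edge
  edge-connected u v u∈ v∈ =
    let l , w = edge-linked u∈ v∈ in l , walk-chain w , walk-head w , walk-last w

  -- A walk without backtracking that once moves away from the root keeps doing so.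
  descent : ∀ {a b z l} → Child a b → Walk edge b z l → Unique (a ∷ l) →
            (∃ λ q → q ∈ a ∷ l × Child q z) × depth a < depth z
  descent {a} ab (stop _) _ = (a , here refl , ab) , child-depth ab
  descent ab (e ◂ w) ((_ ∷ a∉) ∷ uq) with edge⁻ e
  ... | inj₁ bc = let (q , q∈ , qz) , b<z = descent bc w uq in
                  (q , there q∈ , qz) , <-trans (child-depth ab) b<z
  ... | inj₂ (_ , _ , refl) with ab
  ...   | _ , _ , refl = contradiction refl (All.lookup a∉ (start∈ w))

  -- Without backtracking a walk climbs first and, from its first downward step on, descends: either
  -- it never descends, or its last step leads from a parent to its child.
  ascent : ∀ {a z l} → Walk edge a z l → Unique l →
           depth z ≤ depth a ⊎ (∃ λ q → q ∈ l × Child q z)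
  ascent (stop _) _ = inj₁ ≤-refl
  ascent (e ◂ w) (a∉ ∷ uq) with edge⁻ e
  ... | inj₁ ab = inj₂ (proj₁ (descent ab w (a∉ ∷ uq)))
  ... | inj₂ ba with ascent w uq
  ...   | inj₁ z≤b           = inj₁ (≤-trans z≤b (<⇒≤ (child-depth ba)))
  ...   | inj₂ (q , q∈ , qz) = inj₂ (q , there q∈ , qz)

  -- The edge closing the cycle must continue the direction of the last step, and the
  -- direction of the first step must continue that of the closing edge; so the cycle
  -- is monotone in depth.
  no-cycle : ∀ {v₀ v₁ v₂ z l} → edge v₀ v₁ ≡ true → edge v₁ v₂ ≡ true → Walk edge v₂ z l →
             Unique (v₀ ∷ v₁ ∷ l) → edge z v₀ ≢ true
  no-cycle e₀ e₁ w (v₀∉ ∷ uq) e with edge⁻ e₀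
  no-cycle {v₀} e₀ e₁ w (v₀∉@(_ ∷ _) ∷ uq) e | inj₁ c₀₁ with edge⁻ e₁
  ... | inj₂ (_ , _ , refl) with c₀₁
  ...   | _ , _ , refl = contradiction refl (All.lookup v₀∉ (there (start∈ w)))
  no-cycle {v₀} e₀ e₁ w (v₀∉@(_ ∷ _) ∷ uq) e | inj₁ c₀₁ | inj₁ c₁₂ with descent c₁₂ w uq | edge⁻ e
  ... | (q , q∈ , _ , _ , refl) , _ | inj₂ (_ , _ , refl) = contradiction refl (All.lookup v₀∉ q∈)
  ... | _ , v₁<z | inj₁ cz₀ = <-asym (child-depth cz₀) (<-trans (child-depth c₀₁) v₁<z)
  no-cycle {v₀} e₀ e₁ w (v₀∉ ∷ uq@(v₁∉ ∷ _)) e | inj₂ c₁₀@(_ , _ , refl) with edge⁻ e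
  ... | inj₁ (_ , _ , refl) = contradiction refl (All.lookup v₁∉ (end∈ w))
  ... | inj₂ c₀z with ascent (e₁ ◂ w) uq
  ...   | inj₁ z≤v₁ = <-irrefl refl (≤-trans (≤-trans (child-depth c₀z) z≤v₁) (<⇒≤ (child-depth c₁₀)))
  ...   | inj₂ (q , q∈ , _ , _ , refl) with c₀z
  ...     | _ , _ , refl = contradiction refl (All.lookup v₀∉ q∈)

  edge-acyclic : ¬ CycleIn edge
  edge-acyclic c = go cchain cdistinct clong cclosed
    where
    open CycleIn c
    go : ∀ {l} → Chain edge l → Unique l → 3 ≤ length l →
         (∀ x y → head l ≡ just x → last l ≡ just y → edge y x ≡ true) → ⊥
    go (step e₀ (step e₁ ch)) uq _ cl with lastOf ch
      where
      lastOf : ∀ {x l} → Chain edge (x ∷ l) → ∃ λ z → last (x ∷ l) ≡ just z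
      lastOf (one x)    = x , refl
      lastOf (step _ c) = lastOf c
    ... | z , lz = no-cycle e₀ e₁ (chain-walk ch refl lz) uq (cl _ z refl lz)
    go (one _) _ (s≤s ()) _
    go (step _ (one _)) _ (s≤s (s≤s ())) _

  -- The parent is already the one neighbour of the leaf, so a child would have to be the parent.
  leaf-childless : ∀ {x} → x ≢ root → Leaf mem edge x → ∀ {v} → ¬ Child x v
  leaf-childless x≢r (x∈ , d1) c =
    ¬mutual-child c (x∈ , x≢r , ≡.sym (degR-1-unique edge (parent-edge x∈ x≢r) d1 (edge⁺ (inj₁ c))))

open Rooted

Within : Rooted n → (Fin n → Fin n → Bool) → Set
Within R H = ∀ {v} → mem R v ≡ true → v ≢ root R → H v (par R v) ≡ true

within-edge : (R : Rooted n) {H : Fin n → Fin n → Bool} → (∀ x y → H x y ≡ H y x) → Within R H →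
              ∀ x y → edge R x y ≡ true → H x y ≡ true
within-edge R sy W x y e with edge⁻ R e
... | inj₁ (y∈ , y≢r , refl) = trans (sy _ _) (W y∈ y≢r)
... | inj₂ (x∈ , x≢r , refl) = W x∈ x≢r

toTree : (G : Graph n) (R : Rooted n) → Within R (adj G) → Tree G
toTree G R W = record
  { inV = mem R ; inE = edge R ; E-sym = edge-sym R
  ; E⊆G = within-edge R (sym G) W
  ; E⊆V = λ _ _ → edge⇒mem R
  ; nonempty = root R , root∈ R
  ; connected = edge-connected R
  ; acyclic = edge-acyclic R }

-- The vertex must be the root, having no parent edge; any other vertex would have an ancestor, or
-- itself, as a child of the root.
isolated : (R : Rooted n) → ∀ {a v} → degR (edge R) a ≡ 0 → mem R a ≡ true → mem R v ≡ true → v ≡ a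
isolated R {a} d0 a∈ v∈ with a ≟ root R
... | no a≢r = contradiction (parent-edge R a∈ a≢r) (degR-zero (edge R) d0)
... | yes refl = go (depth-above R v∈) v∈
  where
  go : ∀ {d v} → Above (root R) (par R) d v → mem R v ≡ true → v ≡ root R
  go top           _  = refl
  go (hop v≢r abv) v∈ =
    contradiction (edge⁺ R (inj₁ (v∈ , v≢r , go abv (par∈ R v∈ v≢r)))) (degR-zero (edge R) d0)

-- Attaching a pendant vertex

module Attach (R : Rooted n) {a b : Fin n} (a∈ : mem R a ≡ true) (b∉ : mem R b ≢ true) where

  private
    mem′ : Fin n → Bool
    mem′ = updateAt (mem R) b (const true)

    par′ : Fin n → Fin n
    par′ = updateAt (par R) b (const a)

    mem-b : mem′ b ≡ true
    mem-b = updateAt-updates b (mem R)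

    par-b : par′ b ≡ a
    par-b = updateAt-updates b (par R)

    ∈⇒≢b : ∀ {v} → mem R v ≡ true → v ≢ b
    ∈⇒≢b v∈ refl = b∉ v∈

    par-old : ∀ {v} → v ≢ b → par′ v ≡ par R v
    par-old v≢b = updateAt-minimal _ b (par R) v≢b

    mem-old : ∀ {v} → v ≢ b → mem′ v ≡ mem R v
    mem-old v≢b = updateAt-minimal _ b (mem R) v≢b

  mem⁺ : mem R ⊆ mem′
  mem⁺ v v∈ = trans (mem-old (∈⇒≢b v∈)) v∈

  mem⁻ : ∀ {v} → mem′ v ≡ true → v ≡ b ⊎ mem R v ≡ true
  mem⁻ {v} v∈ with v ≟ b
  ... | yes v≡b = inj₁ v≡b
  ... | no v≢b  = inj₂ (trans (≡.sym (mem-old v≢b)) v∈)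

  private
    above-old : ∀ {d v} → mem R v ≡ true → Above (root R) (par R) d v → Above (root R) par′ d v
    above-old v∈ top           = top
    above-old v∈ (hop v≢r abv) =
      hop v≢r (subst (Above _ _ _) (≡.sym (par-old (∈⇒≢b v∈))) (above-old (par∈ R v∈ v≢r) abv))

    b≢r : b ≢ root R
    b≢r refl = b∉ (root∈ R)

  attached : Rooted n
  attached = record
    { mem = mem′ ; root = root R ; par = par′
    ; root∈ = mem⁺ _ (root∈ R)
    ; par∈ = par∈′
    ; above = above′ }
    where
    par∈′ : ∀ {v} → mem′ v ≡ true → v ≢ root R → mem′ (par′ v) ≡ true
    par∈′ {v} v∈ v≢r with mem⁻ v∈
    ... | inj₁ refl rewrite par-b = mem⁺ a a∈
    ... | inj₂ v∈R rewrite par-old (∈⇒≢b v∈R) = mem⁺ _ (par∈ R v∈R v≢r)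
    above′ : ∀ {v} → mem′ v ≡ true → ∃ λ d → Above (root R) par′ d v
    above′ v∈ with mem⁻ v∈
    ... | inj₁ refl = _ , hop b≢r (subst (Above _ _ _) (≡.sym par-b) (above-old a∈ (depth-above R a∈)))
    ... | inj₂ v∈R = _ , above-old v∈R (depth-above R v∈R)

  b∈ : mem attached b ≡ true
  b∈ = mem-b

  within : {H : Fin n → Fin n → Bool} → Within R H → H b a ≡ true → Within attached H
  within W ba v∈ v≢r with mem⁻ v∈
  ... | inj₁ refl rewrite par-b = ba
  ... | inj₂ v∈R rewrite par-old (∈⇒≢b v∈R) = W v∈R v≢r

  private
    E′ : Fin n → Fin n → Bool
    E′ = edge attached

    child⁻ : ∀ {u v} → v ≢ b → Child attached u v → Child R u v
    child⁻ v≢b (v∈ , v≢r , e) = trans (≡.sym (mem-old v≢b)) v∈ , v≢r , trans (≡.sym (par-old v≢b)) e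

    child⁺ : ∀ {u v} → v ≢ b → Child R u v → Child attached u v
    child⁺ v≢b (v∈ , v≢r , e) = mem⁺ _ v∈ , v≢r , trans (par-old v≢b) e

    child-ab : Child attached a b
    child-ab = mem-b , b≢r , par-b

    a≢b : a ≢ b
    a≢b = ∈⇒≢b a∈

    edge-b : ∀ {q} → E′ b q ≡ true → q ≡ a
    edge-b {q} e with edge⁻ attached e
    ... | inj₂ (_ , _ , refl) = par-b
    ... | inj₁ c@(_ , _ , pq≡b) with q ≟ b
    ...   | yes refl = contradiction (trans (≡.sym par-b) pq≡b) a≢b
    ...   | no q≢b   = contradiction (child-parent∈ R (child⁻ q≢b c)) b∉

    edge-old : ∀ {p q} → p ≢ b → q ≢ b → E′ p q ≡ edge R p q
    edge-old p≢b q≢b = ≡true-ext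
      (edge⁺ R ∘ Sum.map (child⁻ q≢b) (child⁻ p≢b) ∘ edge⁻ attached)
      (edge⁺ attached ∘ Sum.map (child⁺ q≢b) (child⁺ p≢b) ∘ edge⁻ R)

    edge-R-b : ∀ {p} → edge R p b ≡ false
    edge-R-b {p} = ≢true⇒≡false λ e → b∉ (edge⇒mem R (trans (edge-sym R b p) e))

  deg-a : degR E′ a ≡ suc (degR (edge R) a)
  deg-a = countTrue-flip b (edge⁺ attached (inj₁ child-ab)) edge-R-b (λ x x≢b → edge-old a≢b x≢b)

  deg-b : degR E′ b ≡ 1
  deg-b = trans (countTrue-∖ (E′ b) (edge⁺ attached (inj₂ child-ab)))
    (cong suc (countTrue-none {P = E′ b ∖ a} λ x h → let e , x≢a = ∖⁻ (E′ b) {a} {x} h in x≢a (edge-b e)))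

  private
    deg-old : ∀ {p} → p ≢ a → p ≢ b → degR E′ p ≡ degR (edge R) p
    deg-old {p} p≢a p≢b = countTrue-cong same
      where
      same : ∀ q → E′ p q ≡ edge R p q
      same q with q ≟ b
      ... | no q≢b   = edge-old p≢b q≢b
      ... | yes refl = trans (≢true⇒≡false λ e → p≢a (edge-b (trans (edge-sym attached b p) e))) (≡.sym edge-R-b)

    leaf-old : ∀ {x} → x ≢ a → Leaf mem′ E′ x → x ≡ b ⊎ Leaf (mem R) (edge R) x
    leaf-old x≢a (x∈ , d1) with mem⁻ x∈
    ... | inj₁ x≡b = inj₁ x≡b
    ... | inj₂ x∈R = inj₂ (x∈R , trans (≡.sym (deg-old x≢a (∈⇒≢b x∈R))) d1)

    ¬leaf-a : ∀ {d} → degR (edge R) a ≡ suc d → ¬ Leaf mem′ E′ a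
    ¬leaf-a e (_ , d1) = contradiction (trans (≡.sym d1) (trans deg-a (cong suc e))) λ ()

    leaf-other : ∀ {d} → degR (edge R) a ≡ suc d → ∀ x → Leaf mem′ E′ x →
                 x ≡ b ⊎ (Leaf (mem R) (edge R) x × x ≢ a)
    leaf-other e x l with x ≟ a
    ... | yes refl = contradiction l (¬leaf-a e)
    ... | no x≢a   = Sum.map₂ (_, x≢a) (leaf-old x≢a l)

  -- The new leaf `b` replaces `a`, which now has degree two.
  leaves-at-leaf : Leaf (mem R) (edge R) a → leafCount mem′ E′ ≤ leafCount (mem R) (edge R)
  leaves-at-leaf l = leafCount-swap a b l (leaf-other (proj₂ l))

  leaves-at-inner : ∀ {d} → degR (edge R) a ≡ suc d → leafCount mem′ E′ ≤ suc (leafCount (mem R) (edge R))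
  leaves-at-inner e = leafCount-gain b λ x l → Sum.map₂ proj₁ (leaf-other e x l)

  -- A lone vertex is not a leaf, yet attaching to it creates an edge with two leaves; hence this
  -- separate case.
  leaves-at-isolated : degR (edge R) a ≡ 0 → leafCount mem′ E′ ≤ 2
  leaves-at-isolated d0 =
    ≤-trans (countTrue-⊆-suc {Q = updateAt (const false) a (const true)} b covered)
      (s≤s (≤-trans (countTrue-⊆-suc {Q = const false} a only-a)
        (s≤s (≤-reflexive (countTrue-none {n = n} {P = const false} λ _ ())))))
    where
    covered : ∀ x → isLeaf mem′ E′ x ≡ true → x ≡ b ⊎ updateAt (const false) a (const true) x ≡ true
    covered x h with mem⁻ (proj₁ (isLeaf⁻ mem′ E′ h))
    ... | inj₁ x≡b = inj₁ x≡b
    ... | inj₂ x∈R rewrite isolated R d0 a∈ x∈R = inj₂ (updateAt-updates a (const false))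
    only-a : ∀ x → updateAt (const false) a (const true) x ≡ true → x ≡ a ⊎ false ≡ true
    only-a x h with x ≟ a
    ... | yes x≡a = inj₁ x≡a
    ... | no x≢a  = inj₂ (trans (≡.sym (updateAt-minimal x a (const false) x≢a)) h)

  order-attached : countTrue mem′ ≡ suc (countTrue (mem R))
  order-attached = countTrue-flip b mem-b (≢true⇒≡false b∉) λ x x≢b → mem-old x≢b

-- Moving a subtree to a new parent

-- v does not lie on the path from u to the root.
data Avoids (R : Rooted n) (v : Fin n) : Fin n → Set where
  at-root : v ≢ root R → Avoids R v (root R)
  away    : ∀ {p} → p ≢ v → p ≢ root R → Avoids R v (par R p) → Avoids R v p

avoids⇒≢ : {R : Rooted n} {u v : Fin n} → Avoids R v u → u ≢ v
avoids⇒≢ (at-root v≢r)  = ≢-sym v≢r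
avoids⇒≢ (away p≢v _ _) = p≢v

avoids⇒¬child : {R : Rooted n} {u v : Fin n} → Avoids R v u → ¬ Child R v u
avoids⇒¬child (at-root _)   (_ , u≢r , _) = u≢r refl
avoids⇒¬child (away _ _ av) (_ , _ , e)   = avoids⇒≢ av e

-- A vertex without children is an ancestor of no other vertex.
avoids-childless : (R : Rooted n) {v : Fin n} → v ≢ root R → (∀ {q} → ¬ Child R v q) →
                   ∀ {d u} → mem R u ≡ true → u ≢ v → Above (root R) (par R) d u → Avoids R v u
avoids-childless R v≢r ¬ch u∈ u≢v top           = at-root v≢r
avoids-childless R v≢r ¬ch u∈ u≢v (hop u≢r abv) =
  away u≢v u≢r (avoids-childless R v≢r ¬ch (par∈ R u∈ u≢r) (λ e → ¬ch (u∈ , u≢r , e)) abv)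

-- The edge from `v` to its parent is exchanged for the edge from `v` to `u`. If `u` were below `v`,
-- the subtree of `v` would be cut off from the root; `avoid` prevents this.
module Reparent (R : Rooted n) {v u : Fin n} (v∈ : mem R v ≡ true) (v≢r : v ≢ root R)
                (u∈ : mem R u ≡ true) (avoid : Avoids R v u) (u≢w : u ≢ par R v) where

  private
    w : Fin n
    w = par R v

    par′ : Fin n → Fin n
    par′ = updateAt (par R) v (const u)

    par-v : par′ v ≡ u
    par-v = updateAt-updates v (par R)

    par-old : ∀ {p} → p ≢ v → par′ p ≡ par R p
    par-old p≢v = updateAt-minimal _ v (par R) p≢v

    above-avoiding : ∀ {p} → Avoids R v p → ∃ λ d → Above (root R) par′ d p
    above-avoiding (at-root _)       = _ , top
    above-avoiding (away p≢v p≢r av) =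
      _ , hop p≢r (subst (Above _ _ _) (≡.sym (par-old p≢v)) (proj₂ (above-avoiding av)))

    -- A path to the root that meets `v` now turns to `u` there, and from `u` on it avoids `v` and
    -- is unchanged.
    above-all : ∀ {d p} → Above (root R) (par R) d p → ∃ λ e → Above (root R) par′ e p
    above-all top = _ , top
    above-all {p = p} (hop p≢r abv) with p ≟ v
    ... | yes refl = _ , hop p≢r (subst (Above _ _ _) (≡.sym par-v) (proj₂ (above-avoiding avoid)))
    ... | no p≢v   = _ , hop p≢r (subst (Above _ _ _) (≡.sym (par-old p≢v)) (proj₂ (above-all abv)))

  moved : Rooted n
  moved = record
    { mem = mem R ; root = root R ; par = par′
    ; root∈ = root∈ R
    ; par∈ = par∈′
    ; above = λ p∈ → above-all (depth-above R p∈) }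
    where
    par∈′ : ∀ {p} → mem R p ≡ true → p ≢ root R → mem R (par′ p) ≡ true
    par∈′ {p} p∈ p≢r with p ≟ v
    ... | yes refl rewrite par-v = u∈
    ... | no p≢v rewrite par-old p≢v = par∈ R p∈ p≢r

  -- The same `d` is kept, which lets the recursion of `shorten` descend on it.
  above-moved : (∀ {q} → ¬ Child R v q) → ∀ {d p} → mem R p ≡ true → p ≢ v →
                Above (root R) (par R) d p → Above (root R) (par moved) d p
  above-moved ¬ch p∈ p≢v top           = top
  above-moved ¬ch p∈ p≢v (hop p≢r abv) =
    hop p≢r (subst (Above _ _ _) (≡.sym (par-old p≢v))
                   (above-moved ¬ch (par∈ R p∈ p≢r) (λ e → ¬ch (p∈ , p≢r , e)) abv))

  within : {H : Fin n → Fin n → Bool} → Within R H → H v u ≡ true → Within moved H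
  within W vu {p} p∈ p≢r with p ≟ v
  ... | yes refl rewrite par-v = vu
  ... | no p≢v rewrite par-old p≢v = W p∈ p≢r

  private
    E E′ : Fin n → Fin n → Bool
    E  = edge R
    E′ = edge moved

    child⁻ : ∀ {p q} → q ≢ v → Child moved p q → Child R p q
    child⁻ q≢v (q∈ , q≢r , e) = q∈ , q≢r , trans (≡.sym (par-old q≢v)) e

    child⁺ : ∀ {p q} → q ≢ v → Child R p q → Child moved p q
    child⁺ q≢v (q∈ , q≢r , e) = q∈ , q≢r , trans (par-old q≢v) e

    child-uv : Child moved u v
    child-uv = v∈ , v≢r , par-v

    child-wv : Child R w v
    child-wv = v∈ , v≢r , refl

    edge-old : ∀ {p q} → p ≢ v → q ≢ v → E′ p q ≡ E p q
    edge-old p≢v q≢v = ≡true-ext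
      (edge⁺ R ∘ Sum.map (child⁻ q≢v) (child⁻ p≢v) ∘ edge⁻ moved)
      (edge⁺ moved ∘ Sum.map (child⁺ q≢v) (child⁺ p≢v) ∘ edge⁻ R)

    u≢v : u ≢ v
    u≢v = avoids⇒≢ avoid

    w≢v : w ≢ v
    w≢v e = ¬self-child R (v∈ , v≢r , e)

    edge′-v : ∀ {q} → E′ v q ≡ true → q ≡ u ⊎ (q ≢ v × Child R v q)
    edge′-v {q} e with edge⁻ moved e
    ... | inj₂ (_ , _ , refl) = inj₁ par-v
    ... | inj₁ c with q ≟ v
    ...   | yes refl = contradiction c (¬self-child moved)
    ...   | no q≢v   = inj₂ (q≢v , child⁻ q≢v c)

    Evu : E v u ≡ false
    Evu = edge-false R (avoids⇒¬child avoid) λ (_ , _ , e) → u≢w (≡.sym e)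

    E′vw : E′ v w ≡ false
    E′vw = ≢true⇒≡false λ e → Sum.[ (λ w≡u → u≢w (≡.sym w≡u)) , (λ (_ , c) → ¬mutual-child R child-wv c) ] (edge′-v e)

    edge-v-old : ∀ {q} → q ≢ u → q ≢ w → E′ v q ≡ E v q
    edge-v-old {q} q≢u q≢w = ≡true-ext (edge⁺ R ∘ to ∘ edge⁻ moved) (edge⁺ moved ∘ from ∘ edge⁻ R)
      where
      to : Child moved v q ⊎ Child moved q v → Child R v q ⊎ Child R q v
      to c with edge′-v (edge⁺ moved c)
      ... | inj₁ q≡u      = contradiction q≡u q≢u
      ... | inj₂ (_ , c′) = inj₁ c′
      from : Child R v q ⊎ Child R q v → Child moved v q ⊎ Child moved q v
      from (inj₂ (_ , _ , e)) = contradiction (≡.sym e) q≢w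
      from (inj₁ c) with q ≟ v
      ... | yes refl = contradiction c (¬self-child R)
      ... | no q≢v   = inj₁ (child⁺ q≢v c)

  -- The neighbour `w` is traded for `u`; both degrees exceed by one the count of `E v` without `w`.
  deg-v : degR E′ v ≡ degR E v
  deg-v = trans (countTrue-flip u (edge⁺ moved (inj₂ child-uv)) (trans (∖-other (E v) u≢w) Evu) same)
                (≡.sym (countTrue-∖ (E v) (edge⁺ R (inj₂ child-wv))))
    where
    same : ∀ q → q ≢ u → E′ v q ≡ (E v ∖ w) q
    same q q≢u with q ≟ w
    ... | yes refl = trans E′vw (≡.sym (∖-at (E v) w))
    ... | no q≢w   = trans (edge-v-old q≢u q≢w) (≡.sym (∖-other (E v) q≢w))

  deg-u : degR E′ u ≡ suc (degR E u)
  deg-u = countTrue-flip v (edge⁺ moved (inj₁ child-uv)) (trans (edge-sym R u v) Evu) λ q q≢v → edge-old u≢v q≢v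

  deg-w : degR E w ≡ suc (degR E′ w)
  deg-w = countTrue-flip v (edge⁺ R (inj₁ child-wv)) (trans (edge-sym moved w v) E′vw)
                         λ q q≢v → ≡.sym (edge-old w≢v q≢v)

  deg-old : ∀ {p} → p ≢ u → p ≢ w → degR E′ p ≡ degR E p
  deg-old {p} p≢u p≢w with p ≟ v
  ... | yes refl = deg-v
  ... | no p≢v = countTrue-cong same
    where
    same : ∀ q → E′ p q ≡ E p q
    same q with q ≟ v
    ... | no q≢v   = edge-old p≢v q≢v
    ... | yes refl = trans (edge-sym moved p v) (trans (edge-v-old p≢u p≢w) (edge-sym R v p))

  private
    leaf-other : Leaf (mem R) E u → ∀ x → Leaf (mem R) E′ x → x ≡ w ⊎ (Leaf (mem R) E x × x ≢ u)
    leaf-other (_ , du) x (x∈ , d1) with x ≟ u | x ≟ w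
    ... | yes refl | _ = contradiction (trans (≡.sym d1) (trans deg-u (cong suc du))) λ ()
    ... | no _ | yes x≡w = inj₁ x≡w
    ... | no x≢u | no x≢w = inj₂ ((x∈ , trans (≡.sym (deg-old x≢u x≢w)) d1) , x≢u)

  -- The leaf `u` gains a second neighbour, and `w`, the only vertex whose degree falls, keeps at
  -- least two.
  leaves-branch : Leaf (mem R) E u → 3 ≤ degR E w → leafCount (mem R) E′ < leafCount (mem R) E
  leaves-branch lu 3≤ = leafCount-drop u lu λ x l → Sum.[ (λ { refl → ⊥-elim (¬leaf-w l) }) , (λ h → h) ] (leaf-other lu x l)
    where
    ¬leaf-w : ¬ Leaf (mem R) E′ w
    ¬leaf-w (_ , d1) with ≤-trans 3≤ (≤-reflexive (trans deg-w (cong suc d1)))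
    ... | s≤s (s≤s ())

  -- The lost leaf `u` pays for `w`, the only vertex that can become a leaf.
  leaves-through : Leaf (mem R) E u → leafCount (mem R) E′ ≤ leafCount (mem R) E
  leaves-through lu = leafCount-swap u w lu (leaf-other lu)

-- Rooting a given tree

single : Fin n → Rooted n
single r = record
  { mem = updateAt (const false) r (const true) ; root = r ; par = λ v → v
  ; root∈ = updateAt-updates r (const false)
  ; par∈ = λ v∈ _ → v∈
  ; above = λ v∈ → _ , subst (Above _ _ zero) (≡.sym (single⁻ v∈)) top }
  where
  single⁻ : ∀ {v} → updateAt (const false) r (const true) v ≡ true → v ≡ r
  single⁻ {v} v∈ with v ≟ r
  ... | yes v≡r = v≡r
  ... | no v≢r = contradiction (updateAt-minimal v r (const false) v≢r) (true≢false v∈)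

single-mem : {r v : Fin n} → mem (single r) v ≡ true → v ≡ r
single-mem {r = r} {v} v∈ with v ≟ r
... | yes v≡r = v≡r
... | no v≢r = contradiction (updateAt-minimal v r (const false) v≢r) (true≢false v∈)

single-within : {r : Fin n} (H : Fin n → Fin n → Bool) → Within (single r) H
single-within H v∈ v≢r = contradiction (single-mem v∈) v≢r

single-edge : {r x y : Fin n} → edge (single r) x y ≢ true
single-edge {r = r} e with edge⁻ (single r) e
... | inj₁ (y∈ , y≢r , _) = y≢r (single-mem y∈)
... | inj₂ (x∈ , x≢r , _) = x≢r (single-mem x∈)

module _ {G : Graph n} (T : Tree G) where

  private
    -- While a vertex of `T` is missing, connectedness gives an edge of `T` leaving `R`, and its
    -- outer end is attached. `fuel` bounds the number of missing vertices.
    grow : ∀ fuel (R : Rooted n) → mem R ⊆ inV T → Within R (inE T) →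
           countTrue (inV T) ≤ fuel + countTrue (mem R) →
           ∃ λ R′ → root R′ ≡ root R × (∀ v → mem R′ v ≡ inV T v) × Within R′ (inE T)
    grow fuel R sub W le with any? (λ v → (inV T v ≟ᵇ true) ×-dec ¬? (mem R v ≟ᵇ true))
    ... | no full = R , refl , (λ v → ≡true-ext (sub v) (all∈ v)) , W
      where
      all∈ : inV T ⊆ mem R
      all∈ v v∈ with mem R v ≟ᵇ true
      ... | yes v∈R = v∈R
      ... | no v∉R  = contradiction (v , v∈ , v∉R) full
    grow zero R sub W le | yes (v , v∈ , v∉) = contradiction le′ (<-irrefl refl)
      where
      le′ : countTrue (inV T) < countTrue (inV T)
      le′ = ≤-trans (s≤s le) (≤-trans
        (s≤s (countTrue-mono {Q = inV T ∖ v} λ u u∈ → ∖⁺ (inV T) (sub u u∈) λ { refl → v∉ u∈ }))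
        (≤-reflexive (≡.sym (countTrue-∖ (inV T) v∈))))
    grow (suc fuel) R sub W le | yes (v , v∈ , v∉)
      with crossing (mem R) (proj₂ (connectedOn-linked (connected T) (sub _ (root∈ R)) v∈)) (root∈ R) v∉
    ... | a , b , a∈ , b∉ , ab =
      grow fuel A.attached sub′ (A.within W ba)
        (≤-trans le (≤-reflexive (trans (≡.sym (+-suc fuel _)) (cong (fuel +_) (≡.sym A.order-attached)))))
      where
      module A = Attach R a∈ b∉
      ba : inE T b a ≡ true
      ba = trans (E-sym T b a) ab
      sub′ : mem A.attached ⊆ inV T
      sub′ u u∈ with A.mem⁻ u∈
      ... | inj₁ refl = E⊆V T _ _ ba
      ... | inj₂ u∈R  = sub u u∈R

    -- An edge of T missing from R would close a cycle with the path of R between its ends.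
    within⇒edge : ∀ R → (∀ v → mem R v ≡ inV T v) → Within R (inE T) →
                  ∀ x y → inE T x y ≡ true → edge R x y ≡ true
    within⇒edge R same W x y xy with edge R x y ≟ᵇ true
    ... | yes e = e
    ... | no ¬e = contradiction (loop-erase (proj₂ (edge-linked R x∈ y∈))) λ (_ , w , uq) → no-path w uq
      where
      x∈ : mem R x ≡ true
      x∈ = trans (same x) (E⊆V T x y xy)
      yx : inE T y x ≡ true
      yx = trans (E-sym T y x) xy
      y∈ : mem R y ≡ true
      y∈ = trans (same y) (E⊆V T y x yx)
      closing : ∀ {l} → Walk (edge R) x y l → ∀ u v → head l ≡ just u → last l ≡ just v → inE T v u ≡ true
      closing w u v hu lv with just-injective (trans (≡.sym (walk-head w)) hu)
                             | just-injective (trans (≡.sym (walk-last w)) lv)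
      ... | refl | refl = yx
      no-path : ∀ {l} → Walk (edge R) x y l → ¬ Unique l
      no-path (stop x) _ = contradiction (irrefl G x) (true≢false (E⊆G T x x xy))
      no-path (e ◂ stop y) _ = ¬e e
      no-path w@(_ ◂ _ ◂ w′) uq = acyclic T record
        { cverts = _ ; cdistinct = uq ; clong = s≤s (s≤s (nonempty-walk w′))
        ; cchain = walk-chain (walk-map (within-edge R (E-sym T) W) w)
        ; cclosed = closing w }
        where
        nonempty-walk : ∀ {u v l} → Walk (edge R) u v l → 1 ≤ length l
        nonempty-walk (stop _) = s≤s z≤n
        nonempty-walk (_ ◂ _)  = s≤s z≤n

  -- Surgery may thus start from any vertex as root; pointwise agreement carries leaves and order
  -- across.
  rootAt : ∀ {r} → inV T r ≡ true →
           ∃ λ R → root R ≡ r × (∀ v → mem R v ≡ inV T v) × (∀ x y → edge R x y ≡ inE T x y)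
  rootAt {r} r∈ with grow (countTrue (inV T)) (single r) (λ v v∈ → trans (cong (inV T) (single-mem v∈)) r∈)
                          (single-within (inE T)) (m≤m+n _ _)
  ... | R , refl , same , W =
    R , refl , same , λ x y → ≡true-ext (within-edge R (E-sym T) W x y) (within⇒edge R same W x y)

within-adj : {G : Graph n} (T : Tree G) (R : Rooted n) → (∀ x y → edge R x y ≡ inE T x y) → Within R (adj G)
within-adj T R same v∈ v≢r = E⊆G T _ _ (trans (≡.sym (same _ _)) (parent-edge R v∈ v≢r))

-- Losing a leaf when two leaves are adjacent

Reduction : Graph n → (Fin n → Bool) → ℕ → Set
Reduction G V ℓ = Σ (Tree G) λ T → leaves T < ℓ × (∀ v → inV T v ≡ V v)

-- The root has no child besides `x`, and nothing hangs below `x`: the tree is a single edge.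
only-child : (R : Rooted n) → Leaf (mem R) (edge R) (root R) → ∀ {x} → Child R (root R) x →
             (∀ {q} → ¬ Child R x q) → ∀ {d v} → mem R v ≡ true → v ≢ root R →
             Above (root R) (par R) d v → v ≡ x
only-child R _ _ _ _ v≢r top = contradiction refl v≢r
only-child R lr@(_ , d1) rx ¬ch {v = v} v∈ v≢r (hop _ abv) with par R v ≟ root R
... | yes e = degR-1-unique (edge R) (edge⁺ R (inj₁ rx)) d1 (edge⁺ R (inj₁ (v∈ , v≢r , e)))
... | no p≢r = contradiction (v∈ , v≢r , only-child R lr rx ¬ch (par∈ R v∈ v≢r) p≢r abv) ¬ch

-- The vertex `par R v` has `v` below it and its own parent above it.
inner-degree : (R : Rooted n) {v : Fin n} → mem R v ≡ true → v ≢ root R → par R v ≢ root R →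
               ∃ λ d → degR (edge R) (par R v) ≡ suc (suc d)
inner-degree R v∈ v≢r w≢r =
  degR-≥2 (edge R) (child-edge R v∈ v≢r) (parent-edge R (par∈ R v∈ v≢r) w≢r)
    λ e → ¬mutual-child R (v∈ , v≢r , refl) (par∈ R v∈ v≢r , w≢r , e)

exactly-two : ∀ {e d} → e ≡ suc (suc d) → ¬ 3 ≤ e → e ≡ 2
exactly-two {d = zero}  refl _   = refl
exactly-two {d = suc _} refl ¬3≤ = contradiction (s≤s (s≤s (s≤s z≤n))) ¬3≤

-- Hang x below y; if the old parent w of x is a branch vertex, a leaf is lost, and
-- otherwise w becomes a leaf adjacent to the leaf x, and is closer to the root than x.
shorten : (G : Graph n) → ∀ {d} (R : Rooted n) → Within R (adj G) → ∀ {x y} →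
          Leaf (mem R) (edge R) (root R) → x ≢ root R → y ≢ root R → x ≢ y →
          Leaf (mem R) (edge R) x → Leaf (mem R) (edge R) y → adj G x y ≡ true →
          Above (root R) (par R) d x → Reduction G (mem R) (leafCount (mem R) (edge R))
shorten G R W _ x≢r _ _ _ _ _ top = contradiction refl x≢r
shorten {n} G R W {x} {y} lr x≢r y≢r x≢y lx ly xy (hop _ abw) = by-degree (par R x ≟ root R) (3 ≤? degR (edge R) w)
  where
  w : Fin n
  w = par R x
  x∈ : mem R x ≡ true
  x∈ = proj₁ lx
  ¬ch : ∀ {q} → ¬ Child R x q
  ¬ch = leaf-childless R x≢r lx
  avoid : Avoids R x y
  avoid = avoids-childless R x≢r ¬ch (proj₁ ly) (≢-sym x≢y) (depth-above R (proj₁ ly))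
  w≢x : w ≢ x
  w≢x e = ¬self-child R (x∈ , x≢r , e)
  by-degree : Dec (w ≡ root R) → Dec (3 ≤ degR (edge R) w) → Reduction G (mem R) (leafCount (mem R) (edge R))
  -- With `x` directly below a leaf root the tree would be one edge, leaving no room for `y`.
  by-degree (yes w≡r) _ =
    contradiction (only-child R lr (x∈ , x≢r , w≡r) ¬ch (proj₁ ly) y≢r (depth-above R (proj₁ ly))) (≢-sym x≢y)
  by-degree (no w≢r) branch = by-branch branch
    where
    deg≥2 : ∃ λ d → degR (edge R) w ≡ suc (suc d)
    deg≥2 = inner-degree R x∈ x≢r w≢r
    y≢w : y ≢ w
    y≢w y≡w = contradiction (trans (≡.sym (proj₂ ly)) (trans (cong (degR (edge R)) y≡w) (proj₂ deg≥2))) λ ()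
    module M = Reparent R x∈ x≢r (proj₁ ly) avoid y≢w
    W′ : Within M.moved (adj G)
    W′ = M.within W xy
    by-branch : Dec (3 ≤ degR (edge R) w) → Reduction G (mem R) (leafCount (mem R) (edge R))
    by-branch (yes 3≤) = toTree G M.moved W′ , M.leaves-branch ly 3≤ , λ _ → refl
    by-branch (no ¬3≤) =
      let T , fewer , same =
            shorten G M.moved W′
              (root∈ R , trans (M.deg-old (≢-sym y≢r) (≢-sym w≢r)) (proj₂ lr))
              w≢r x≢r w≢x
              (par∈ R x∈ x≢r , suc-injective (trans (≡.sym M.deg-w) (exactly-two (proj₂ deg≥2) ¬3≤)))
              (x∈ , trans M.deg-v (proj₂ lx))
              (trans (sym G w x) (W x∈ x≢r))
              (M.above-moved ¬ch (par∈ R x∈ x≢r) w≢x abw)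
      -- The move cost the leaf `y` when it created the leaf `w`, so the loss in the recursive call
      -- is a loss for `R`.
      in T , ≤-trans fewer (M.leaves-through ly) , same

-- A third leaf is taken as root: the paths to it from `x` and `y` then meet at a branch vertex,
-- which is where `shorten` loses a leaf.
adjacent-leaves : {G : Graph n} (T : Tree G) → 3 ≤ leaves T → ∀ {x y} →
                  Leaf (inV T) (inE T) x → Leaf (inV T) (inE T) y → x ≢ y → adj G x y ≡ true →
                  Reduction G (inV T) (leaves T)
adjacent-leaves {n} {G} T 3≤ {x} {y} lx ly x≢y xy with leafCount-third (inV T) (inE T) 3≤ x y
... | z , lz , z≢x , z≢y with rootAt T (proj₁ lz)
...   | R , refl , sameV , sameE =
  let T′ , fewer , same = shorten G R (within-adj T R sameE) (transport lz) (≢-sym z≢x) (≢-sym z≢y) x≢y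
                            (transport lx) (transport ly) xy (depth-above R (proj₁ (transport lx)))
  in T′ , ≤-trans fewer (≤-reflexive (leafCount-cong sameV sameE)) , λ v → trans (same v) (sameV v)
  where
  transport : ∀ {v} → Leaf (inV T) (inE T) v → Leaf (mem R) (edge R) v
  transport {v} (v∈ , d1) = trans (sameV v) v∈ , trans (countTrue-cong (sameE v)) d1

-- Largest trees with at most K + 1 leaves

module Largest (G : Graph n) (G-connected : Connected G) (K t : ℕ) (1≤K : 1 ≤ K)
               (largest : ∀ (T : Tree G) → leaves T ≤ suc K → countTrue (inV T) ≤ t) where

  too-large : (R : Rooted n) → countTrue (mem R) ≡ t → ∀ {a b} (a∈ : mem R a ≡ true) (b∉ : mem R b ≢ true) →
              Within R (adj G) → adj G a b ≡ true →
              ¬ leafCount (mem (Attach.attached R a∈ b∉)) (edge (Attach.attached R a∈ b∉)) ≤ suc K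
  too-large R size {a} {b} a∈ b∉ W ab few = <-irrefl refl (≤-trans
    (≤-reflexive (≡.sym (trans A.order-attached (cong suc size))))
    (largest (toTree G A.attached (A.within W (trans (sym G b a) ab))) few))
    where module A = Attach R a∈ b∉

  -- A missed vertex adjacent to the tree could be attached with at most `K + 1` leaves, against the
  -- maximality of `t`.
  spanning : (T : Tree G) → leaves T ≤ K → countTrue (inV T) ≡ t → ∀ v → inV T v ≡ true
  spanning T few size v with inV T v ≟ᵇ true
  ... | yes v∈ = v∈
  ... | no v∉ with connected-crossing
    where
    r∈ : inV T (proj₁ (Tree.nonempty T)) ≡ true
    r∈ = proj₂ (Tree.nonempty T)
    connected-crossing : ∃ λ a → ∃ λ b → inV T a ≡ true × inV T b ≢ true × adj G a b ≡ true
    connected-crossing = crossing (inV T) (proj₂ (connectedOn-linked G-connected refl refl)) r∈ v∉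
  ...   | a , b , a∈ , b∉ , ab with rootAt T a∈
  ...     | R , refl , sameV , sameE =
    contradiction attached-few (too-large R (trans (countTrue-cong sameV) size) a∈R b∉R (within-adj T R sameE) ab)
    where
    a∈R : mem R (root R) ≡ true
    a∈R = trans (sameV _) a∈
    b∉R : mem R b ≢ true
    b∉R b∈ = b∉ (trans (≡.sym (sameV b)) b∈)
    module A = Attach R a∈R b∉R
    by-degree : ∀ d → degR (edge R) (root R) ≡ d → leafCount (mem A.attached) (edge A.attached) ≤ suc K
    -- A one-vertex tree acquires two leaves, and 2 ≤ `K + 1`.
    by-degree zero    e = ≤-trans (A.leaves-at-isolated e) (s≤s 1≤K)
    by-degree (suc _) e =
      ≤-trans (A.leaves-at-inner e) (s≤s (≤-trans (≤-reflexive (leafCount-cong sameV sameE)) few))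
    attached-few : leafCount (mem A.attached) (edge A.attached) ≤ suc K
    attached-few = by-degree _ refl

  -- `few` and `many` fix the number of leaves at `K + 1`. The condition `stable` restricts `y`
  -- alone: the root may still be adjacent to a leaf other than `y`.
  module Exchange (R : Rooted n) (W : Within R (adj G)) (few : leafCount (mem R) (edge R) ≤ suc K)
                  (size : countTrue (mem R) ≡ t) (lx : Leaf (mem R) (edge R) (root R))
                  {y : Fin n} (ly : Leaf (mem R) (edge R) y) (y≢x : y ≢ root R)
                  (stable : ∀ {w} → Leaf (mem R) (edge R) w → adj G y w ≢ true)
                  (many : suc K ≤ leafCount (mem R) (edge R)) (2≤K : 2 ≤ K) where

    private
      V : Fin n → Bool
      V = mem R
      E : Fin n → Fin n → Bool
      E = edge R
      x : Fin n
      x = root R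

    -- An outside neighbour could be attached at the leaf without raising the number of leaves.
    leaf-neighbours : ∀ {z v} → Leaf V E z → adj G z v ≡ true → V v ≡ true
    leaf-neighbours {z} {v} lz zv with V v ≟ᵇ true
    ... | yes v∈ = v∈
    ... | no v∉ = contradiction (≤-trans (Attach.leaves-at-leaf R (proj₁ lz) v∉ lz) few)
                                (too-large R size (proj₁ lz) v∉ W zv)

    -- The two cases in which moving the parent edge of `v` over to `x` leads to the loss of a leaf:
    -- the old parent is a branch vertex, or it is adjacent to the leaf `y`.
    Exchangeable : Fin n → Set
    Exchangeable v = adj G x v ≡ true × par R v ≢ x × (3 ≤ degR E (par R v) ⊎ adj G y (par R v) ≡ true)

    exchangeable? : ∀ v → Dec (Exchangeable v)
    exchangeable? v = (adj G x v ≟ᵇ true) ×-dec ¬? (par R v ≟ x) ×-dec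
                      ((3 ≤? degR E (par R v)) ⊎-dec (adj G y (par R v) ≟ᵇ true))

    neighbour-child : ∀ {v} → adj G x v ≡ true → Child R (par R v) v
    neighbour-child xv =
      leaf-neighbours lx xv , (λ { refl → contradiction (irrefl G x) (true≢false xv) }) , refl

    exchange : ∀ {v} → Exchangeable v → Reduction G V (leafCount V E)
    exchange {v} (xv , w≢x , gain) = by-branch (3 ≤? degR E w)
      where
      w : Fin n
      w = par R v
      v∈ : V v ≡ true
      v∈ = proj₁ (neighbour-child xv)
      v≢x : v ≢ x
      v≢x = proj₁ (proj₂ (neighbour-child xv))
      deg≥2 : ∃ λ d → degR E w ≡ suc (suc d)
      deg≥2 = inner-degree R v∈ v≢x w≢x
      module M = Reparent R v∈ v≢x (root∈ R) (at-root v≢x) (≢-sym w≢x)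
      T′ : Tree G
      T′ = toTree G M.moved (M.within {H = adj G} W (trans (sym G v x) xv))
      y≢w : y ≢ w
      y≢w y≡w = contradiction (trans (≡.sym (proj₂ ly)) (trans (cong (degR E) y≡w) (proj₂ deg≥2))) λ ()
      by-branch : Dec (3 ≤ degR E w) → Reduction G V (leafCount V E)
      by-branch (yes 3≤) = T′ , M.leaves-branch lx 3≤ , λ _ → refl
      by-branch (no ¬3≤) = by-count (3 ≤? leaves T′)
        where
        yw : adj G y w ≡ true
        yw = Sum.fromInj₂ (λ 3≤ → contradiction 3≤ ¬3≤) gain
        ly′ : Leaf (inV T′) (inE T′) y
        ly′ = proj₁ ly , trans (M.deg-old y≢x y≢w) (proj₂ ly)
        lw′ : Leaf (inV T′) (inE T′) w
        lw′ = par∈ R v∈ v≢x , suc-injective (trans (≡.sym M.deg-w) (exactly-two (proj₂ deg≥2) ¬3≤))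
        by-count : Dec (3 ≤ leaves T′) → Reduction G V (leafCount V E)
        by-count (yes 3≤) = let T″ , fewer , same = adjacent-leaves T′ 3≤ ly′ lw′ y≢w yw in
                            T″ , ≤-trans fewer (M.leaves-through lx) , same
        -- `adjacent-leaves` asks for three leaves; with at most two, a leaf is already lost, as 2 <
        -- `K + 1`.
        by-count (no ¬3≤) = T′ , ≤-trans (≰⇒> ¬3≤) (≤-trans (s≤s 2≤K) many) , λ _ → refl

    -- Without an exchange, v ↦ par v maps N(x) injectively into V, missing N(y) and all leaves but x.
    degree-bound : ¬ ∃ Exchangeable → deg G x + (deg G y + K) ≤ t
    degree-bound none = begin
      deg G x + (deg G y + K)               ≤⟨ +-monoʳ-≤ (deg G x) (+-monoʳ-≤ (deg G y) K≤) ⟩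
      deg G x + (deg G y + countTrue L)     ≤⟨ +-mono-≤ (countTrue-inj (par R) into inj)
                                                 (countTrue-disjoint {S = S} B⊆S L⊆S disjoint) ⟩
      countTrue C + countTrue S             ≤⟨ countTrue-disjoint C⊆V S⊆V C∩S ⟩
      countTrue V                           ≡⟨ size ⟩
      t                                     ∎
      where
      open ≤-Reasoning
      L : Fin n → Bool
      L = isLeaf V E ∖ x
      -- `S` is N(y) together with the leaves other than `x`; `C` is the rest of `V` and receives
      -- the parents of N(x).
      S? : ∀ w → Dec (adj G y w ≡ true ⊎ L w ≡ true)
      S? w = (adj G y w ≟ᵇ true) ⊎-dec (L w ≟ᵇ true)
      S C : Fin n → Bool
      S w = does (S? w)
      C? : ∀ w → Dec (V w ≡ true × S w ≢ true)
      C? w = (V w ≟ᵇ true) ×-dec ¬? (S w ≟ᵇ true)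
      C w = does (C? w)
      K≤ : K ≤ countTrue L
      K≤ = ≤-pred (≤-trans many (≤-reflexive (countTrue-∖ (isLeaf V E) (isLeaf⁺ V E lx))))
      L⁻ : ∀ {w} → L w ≡ true → Leaf V E w × w ≢ x
      L⁻ Lw = let l , w≢x = ∖⁻ (isLeaf V E) Lw in isLeaf⁻ V E l , w≢x
      B⊆S : adj G y ⊆ S
      B⊆S w yw = dec-true (S? w) (inj₁ yw)
      L⊆S : L ⊆ S
      L⊆S w Lw = dec-true (S? w) (inj₂ Lw)
      disjoint : ∀ w → adj G y w ≡ true → L w ≢ true
      disjoint w yw Lw = stable (proj₁ (L⁻ Lw)) yw
      S⊆V : S ⊆ V
      S⊆V w Sw with does⁻ (S? w) Sw
      ... | inj₁ yw = leaf-neighbours ly yw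
      ... | inj₂ Lw = proj₁ (proj₁ (L⁻ Lw))
      C⊆V : C ⊆ V
      C⊆V w Cw = proj₁ (does⁻ (C? w) Cw)
      C∩S : ∀ w → C w ≡ true → S w ≢ true
      C∩S w Cw = proj₂ (does⁻ (C? w) Cw)
      into : ∀ v → adj G x v ≡ true → C (par R v) ≡ true
      into v xv = dec-true (C? (par R v)) (child-parent∈ R c , λ Sw → misses (does⁻ (S? (par R v)) Sw))
        where
        c : Child R (par R v) v
        c = neighbour-child xv
        misses : ¬ (adj G y (par R v) ≡ true ⊎ L (par R v) ≡ true)
        misses (inj₂ Lw) = let l , w≢x = L⁻ Lw in leaf-childless R w≢x l c
        misses (inj₁ yw) with par R v ≟ x
        -- The root is itself a leaf, hence not in N(y).
        ... | yes w≡x = stable lx (subst (λ w → adj G y w ≡ true) w≡x yw)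
        ... | no w≢x  = none (v , xv , w≢x , inj₂ yw)
      inj : ∀ u v → adj G x u ≡ true → adj G x v ≡ true → par R u ≡ par R v → u ≡ v
      inj u v xu xv e with u ≟ v
      ... | yes u≡v = u≡v
      ... | no u≢v = contradiction e (branching (neighbour-child xu) (neighbour-child xv))
        where
        branching : Child R (par R u) u → Child R (par R v) v → par R u ≢ par R v
        branching cu@(u∈ , u≢x , _) cv@(v∈ , v≢x , _) e with par R u ≟ x
        -- A root that is a leaf has only one child.
        ... | yes w≡x = u≢v (degR-1-unique E
                (edge⁺ R (inj₁ (v∈ , v≢x , trans (≡.sym e) w≡x))) (proj₂ lx) (edge⁺ R (inj₁ (u∈ , u≢x , w≡x))))
        -- Two children and a parent make `par R u` a branch vertex, so `u` would be exchangeable.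
        ... | no w≢x = none (u , xu , w≢x , inj₁ (degR-≥3 E
                (edge⁺ R (inj₁ cu)) (edge⁺ R (inj₁ (v∈ , v≢x , ≡.sym e))) (≢-sym u≢v) (parent-edge R w∈ w≢x)
                (λ p≡u → ¬mutual-child R cu (w∈ , w≢x , p≡u))
                (λ p≡v → ¬mutual-child R (v∈ , v≢x , ≡.sym e) (w∈ , w≢x , p≡v))))
          where
          w∈ : V (par R u) ≡ true
          w∈ = child-parent∈ R cu

  -- The bound on σ₂ with the subtraction moved across; it is vacuous for complete graphs, where σ₂
  -- is infinite.
  DegreeSum : Set
  DegreeSum = ∀ (x y : Fin n) → x ≢ y → adj G x y ≡ false → t + 1 ≤ deg G x + deg G y + K

  module _ (σ : DegreeSum) (2≤K : 2 ≤ K) where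

    -- Two leaves `x` and `y` are fixed. If `y` is adjacent to a leaf, `adjacent-leaves` applies;
    -- otherwise either an exchange is possible or `degree-bound` contradicts `σ`.
    reduce : (T : Tree G) → leaves T ≤ suc K → suc K ≤ leaves T → countTrue (inV T) ≡ t →
             Reduction G (inV T) (leaves T)
    reduce T few many size = by-leaf
      (any? λ w → (isLeaf (inV T) (inE T) w ≟ᵇ true) ×-dec (adj G y w ≟ᵇ true))
      where
      3≤ : 3 ≤ leaves T
      3≤ = ≤-trans (s≤s 2≤K) many
      some : ∃ λ w → isLeaf (inV T) (inE T) w ≡ true
      some = countTrue-positive _ (≤-trans (s≤s z≤n) 3≤)
      x : Fin n
      x = proj₁ some
      lx : Leaf (inV T) (inE T) x
      lx = isLeaf⁻ (inV T) (inE T) (proj₂ some)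
      third : ∃ λ y → Leaf (inV T) (inE T) y × y ≢ x × y ≢ x
      third = leafCount-third (inV T) (inE T) 3≤ x x
      y : Fin n
      y = proj₁ third
      ly : Leaf (inV T) (inE T) y
      ly = proj₁ (proj₂ third)
      y≢x : y ≢ x
      y≢x = proj₁ (proj₂ (proj₂ third))

      by-leaf : Dec (∃ λ w → isLeaf (inV T) (inE T) w ≡ true × adj G y w ≡ true) → Reduction G (inV T) (leaves T)
      by-leaf (yes (w , lw , yw)) =
        adjacent-leaves T 3≤ ly (isLeaf⁻ (inV T) (inE T) lw) (λ { refl → contradiction (irrefl G w) (true≢false yw) }) yw
      by-leaf (no ¬adjacent) with rootAt T (proj₁ lx)
      ... | R , root≡x , sameV , sameE = by-exchange
        where
        W : Within R (adj G)
        W = within-adj T R sameE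
        same : leafCount (mem R) (edge R) ≡ leaves T
        same = leafCount-cong sameV sameE
        few′ : leafCount (mem R) (edge R) ≤ suc K
        few′ = ≤-trans (≤-reflexive same) few
        many′ : suc K ≤ leafCount (mem R) (edge R)
        many′ = ≤-trans many (≤-reflexive (≡.sym same))
        size′ : countTrue (mem R) ≡ t
        size′ = trans (countTrue-cong sameV) size
        transport : ∀ {v} → Leaf (inV T) (inE T) v → Leaf (mem R) (edge R) v
        transport {v} (v∈ , d1) = trans (sameV v) v∈ , trans (countTrue-cong (sameE v)) d1
        transport⁻ : ∀ {v} → Leaf (mem R) (edge R) v → Leaf (inV T) (inE T) v
        transport⁻ {v} (v∈ , d1) = trans (≡.sym (sameV v)) v∈ , trans (≡.sym (countTrue-cong (sameE v))) d1
        lx′ : Leaf (mem R) (edge R) (root R)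
        lx′ = subst (Leaf (mem R) (edge R)) (≡.sym root≡x) (transport lx)
        ly′ : Leaf (mem R) (edge R) y
        ly′ = transport ly
        y≢x′ : y ≢ root R
        y≢x′ e = y≢x (trans e root≡x)
        stable : ∀ {w} → Leaf (mem R) (edge R) w → adj G y w ≢ true
        stable lw yw = ¬adjacent (_ , isLeaf⁺ (inV T) (inE T) (transport⁻ lw) , yw)
        open Exchange R W few′ size′ lx′ ly′ y≢x′ stable many′ 2≤K
        by-exchange : Reduction G (inV T) (leaves T)
        by-exchange with any? exchangeable?
        ... | yes (v , ex) =
          let T′ , fewer , sameV′ = exchange ex
          in T′ , ≤-trans fewer (≤-reflexive same) , λ v → trans (sameV′ v) (sameV v)
        ... | no none = contradiction too-many (<-irrefl refl)
          where
          open ≤-Reasoning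
          r : Fin n
          r = root R
          too-many : t < t
          too-many = begin
            suc t                     ≡⟨ +-comm 1 t ⟩
            t + 1                     ≤⟨ σ r y (≢-sym y≢x′) (trans (sym G r y) (≢true⇒≡false (stable lx′))) ⟩
            deg G r + deg G y + K     ≡⟨ +-assoc (deg G r) (deg G y) K ⟩
            deg G r + (deg G y + K)   ≤⟨ degree-bound none ⟩
            t                         ∎

    -- One reduction suffices: it keeps the vertex set, so the order is still `t`, and leaves at
    -- most `K` leaves.
    spanning-tree : (T : Tree G) → leaves T ≤ suc K → countTrue (inV T) ≡ t →
                    Σ (Tree G) λ T′ → leaves T′ ≤ K × (∀ v → inV T′ v ≡ true)
    spanning-tree T few size with leaves T ≤? K
    ... | yes few′ = T , few′ , spanning T few′ size
    ... | no ¬few′ with reduce T few (≰⇒> ¬few′) size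
    ...   | T′ , fewer , same =
      let few′ = ≤-pred (≤-trans fewer few) in
      T′ , few′ , spanning T′ few′ (trans (countTrue-cong same) size)

-- Long paths and Hamilton cycles

unique-↭ : {xs ys : List (Fin n)} → xs ↭ ys → Unique xs → Unique ys
unique-↭ p = Unique-resp-↭ (≡.setoid _) (↭⇒↭ₛ p)

∉⇒All≢ : {x : Fin n} {l : List (Fin n)} → x ∉ l → All (x ≢_) l
∉⇒All≢ {l = l} x∉l = ¬Any⇒All¬ l x∉l

countList : (Fin n → Bool) → List (Fin n) → ℕ
countList A []      = 0
countList A (x ∷ l) = indicator (A x) + countList A l

-- `A` stays fixed while `P` loses the list entries already passed, which carries the induction.
countTrue≤countList : {A : Fin n → Bool} (P : Fin n → Bool) (l : List (Fin n)) → P ⊆ A →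
                      (∀ x → P x ≡ true → x ∈ l) → countTrue P ≤ countList A l
countTrue≤countList P [] P⊆A P⊆l = ≤-reflexive (countTrue-none λ x Px → contradiction (P⊆l x Px) λ ())
countTrue≤countList {A = A} P (y ∷ l) P⊆A P⊆l with P y ≟ᵇ true
... | yes Py rewrite countTrue-∖ P Py | P⊆A y Py =
  s≤s (countTrue≤countList (P ∖ y) l (λ x Px → P⊆A x (proj₁ (∖⁻ P Px))) tail∈)
  where
  tail∈ : ∀ x → (P ∖ y) x ≡ true → x ∈ l
  tail∈ x Px with ∖⁻ P Px
  ... | Px′ , x≢y with P⊆l x Px′
  ...   | here x≡y  = contradiction x≡y x≢y
  ...   | there x∈l = x∈l
... | no ¬Py = ≤-trans (countTrue≤countList P l P⊆A tail∈) (m≤n+m _ (indicator (A y)))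
  where
  tail∈ : ∀ x → P x ≡ true → x ∈ l
  tail∈ x Px with P⊆l x Px
  ... | here refl = contradiction Px ¬Py
  ... | there x∈l = x∈l

module _ {R : Fin n → Fin n → Bool} where

  -- A step from a to b with B a and A b; without one, each of the length l ∸ 1 steps
  -- of the walk contributes at most 1 to the two counts.
  crossing-step : (A B : Fin n → Bool) → ∀ {x y l} → Walk R x y l → B y ≡ false →
    (∃ λ a → ∃ λ b → ∃ λ l₁ → ∃ λ l₂ →
       Walk R x a l₁ × Walk R b y l₂ × l ≡ l₁ ++ l₂ × B a ≡ true × A b ≡ true) ⊎
    suc (countList A l + countList B l) ≤ indicator (A x) + length l
  crossing-step A B (stop y) By rewrite By = inj₂ (≤-reflexive (rearrange (indicator (A y))))
    where
    rearrange : ∀ i → suc (i + 0 + 0) ≡ i + 1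
    rearrange = solve-∀
  -- A step is charged for `B` at its first vertex and for `A` at its second. What remains is `A` at
  -- the start of the walk, kept as `indicator (A x)`, and `B` at its end, which is false.
  crossing-step A B (_◂_ {x} {y} {z} {l} e w) Bz with crossing-step A B w Bz
  ... | inj₁ (a , b , l₁ , l₂ , w₁ , w₂ , eq , Ba , Ab) =
    inj₁ (a , b , x ∷ l₁ , l₂ , e ◂ w₁ , w₂ , cong (x ∷_) eq , Ba , Ab)
  ... | inj₂ le with B x ≟ᵇ true | A y ≟ᵇ true
  ...   | yes Bx | yes Ay = inj₁ (x , y , x ∷ [] , l , stop x , w , refl , Bx , Ay)
  ...   | no ¬Bx | _ rewrite ≢true⇒≡false ¬Bx = inj₂ (begin
    suc (i + cA + cB)      ≡⟨ rearrange i cA cB ⟩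
    i + suc (cA + cB)      ≤⟨ +-monoʳ-≤ i le ⟩
    i + (j + length l)     ≤⟨ +-monoʳ-≤ i (+-mono-≤ (indicator≤1 (A y)) ≤-refl) ⟩
    i + suc (length l)     ∎)
    where
    open ≤-Reasoning
    i j cA cB : ℕ
    i = indicator (A x)
    j = indicator (A y)
    cA = countList A l
    cB = countList B l
    rearrange : ∀ i cA cB → suc (i + cA + cB) ≡ i + suc (cA + cB)
    rearrange = solve-∀
    indicator≤1 : ∀ b → indicator b ≤ 1
    indicator≤1 true  = ≤-refl
    indicator≤1 false = z≤n
  ...   | yes Bx | no ¬Ay rewrite Bx | ≢true⇒≡false ¬Ay = inj₂ (begin
    suc (i + cA + suc cB)    ≡⟨ rearrange i cA cB ⟩
    i + suc (suc (cA + cB))  ≤⟨ +-monoʳ-≤ i (s≤s le) ⟩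
    i + suc (length l)       ∎)
    where
    open ≤-Reasoning
    i cA cB : ℕ
    i = indicator (A x)
    cA = countList A l
    cB = countList B l
    rearrange : ∀ i cA cB → suc (i + cA + suc cB) ≡ i + suc (suc (cA + cB))
    rearrange = solve-∀

  split-at : ∀ {x y c l} → Walk R x y l → c ∈ l →
    c ≡ x ⊎ (∃ λ a → ∃ λ l₁ → ∃ λ l₂ → Walk R x a l₁ × Walk R c y l₂ × l ≡ l₁ ++ l₂)
  split-at (stop _) (here refl) = inj₁ refl
  split-at (_ ◂ _)  (here refl) = inj₁ refl
  split-at (_◂_ {x} e w) (there c∈) with split-at w c∈
  ... | inj₁ refl = inj₂ (x , x ∷ [] , _ , stop x , w , refl)
  ... | inj₂ (a , l₁ , l₂ , w₁ , w₂ , eq) = inj₂ (a , x ∷ l₁ , l₂ , e ◂ w₁ , w₂ , cong (x ∷_) eq)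

  -- Covers the degenerate cycles: a single vertex, and an edge traversed back and forth.
  Closes : Fin n → Fin n → List (Fin n) → Set
  Closes x y l = l ≡ x ∷ [] ⊎ R y x ≡ true

  -- The walk is cut before `c` and its two parts are swapped; the closing edge joins them.
  rotate : ∀ {x y c l} → Walk R x y l → Closes x y l → c ∈ l → ∃ λ a → ∃ λ l′ → Walk R c a l′ × l ↭ l′
  rotate (stop x) _ (here refl) = x , _ , stop x , ↭-refl
  rotate (_ ◂ ()) (inj₁ refl) _
  rotate w@(_ ◂ _) (inj₂ yx) c∈ with split-at w c∈
  ... | inj₁ refl = _ , _ , w , ↭-refl
  ... | inj₂ (a , l₁ , l₂ , w₁ , w₂ , eq) =
    a , l₂ ++ l₁ , walk-++ w₂ yx w₁ , subst (_↭ l₂ ++ l₁) (≡.sym eq) (++-comm l₁ l₂)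

-- Ore's argument for k = 1

module HamiltonCycles (G : Graph n) (G-connected : Connected G) (t : ℕ)
                      (largest : ∀ (T : Tree G) → leaves T ≤ 2 → countTrue (inV T) ≤ t) where

  -- Turns a path into a tree, so that the bound `t` on trees bounds paths. By `free` the start is a
  -- leaf or the only vertex, so a further vertex can be put in front of it without exceeding two
  -- leaves.
  record PathTree (x : Fin n) (l : List (Fin n)) : Set where
    field
      rooted  : Rooted n
      within  : Within rooted (adj G)
      members : ∀ {v} → mem rooted v ≡ true → v ∈ l
      start   : mem rooted x ≡ true
      size    : countTrue (mem rooted) ≡ length l
      few     : leafCount (mem rooted) (edge rooted) ≤ 2
      free    : degR (edge rooted) x ≡ 1 ⊎ degR (edge rooted) x ≡ 0

  path-tree : ∀ {x y l} → Walk (adj G) x y l → Unique l → PathTree x l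
  path-tree (stop x) _ = record
    { rooted  = single x
    ; within  = single-within (adj G)
    ; members = here ∘ single-mem
    ; start   = root∈ (single x)
    ; size    = trans (countTrue-∖ (mem (single x)) (root∈ (single x)))
                      (cong suc (countTrue-none {P = mem (single x) ∖ x} λ v v∈ →
                        let v∈′ , v≢x = ∖⁻ (mem (single x)) v∈ in v≢x (single-mem v∈′)))
    ; few     = ≤-trans (≤-reflexive (countTrue-none λ v lv →
                  no-leaf v (isLeaf⁻ (mem (single x)) (edge (single x)) lv))) z≤n
    ; free    = inj₂ (degree-zero x) }
    where
    degree-zero : ∀ v → degR (edge (single x)) v ≡ 0
    degree-zero v = countTrue-none {P = edge (single x) v} λ _ → single-edge
    no-leaf : ∀ v → ¬ Leaf (mem (single x)) (edge (single x)) v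
    no-leaf v (_ , d1) = contradiction (trans (≡.sym d1) (degree-zero v)) λ ()
  path-tree (_◂_ {x} {y} {l = l} xy w) (x≢ ∷ uq) = record
    { rooted  = A.attached
    ; within  = A.within {H = adj G} within xy
    ; members = members′
    ; start   = A.b∈
    ; size    = trans A.order-attached (cong suc size)
    ; few     = few′ free
    ; free    = inj₁ A.deg-b }
    where
    open PathTree (path-tree w uq)
    x∉ : mem rooted x ≢ true
    x∉ x∈ = contradiction refl (All.lookup x≢ (members x∈))
    module A = Attach rooted start x∉
    members′ : ∀ {v} → mem A.attached v ≡ true → v ∈ x ∷ l
    members′ v∈ with A.mem⁻ v∈
    ... | inj₁ refl = here refl
    ... | inj₂ v∈R  = there (members v∈R)
    few′ : degR (edge rooted) y ≡ 1 ⊎ degR (edge rooted) y ≡ 0 →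
           leafCount (mem A.attached) (edge A.attached) ≤ 2
    few′ (inj₁ d1) = ≤-trans (A.leaves-at-leaf (start , d1)) few
    few′ (inj₂ d0) = A.leaves-at-isolated d0

  path-bound : ∀ {x y l} → Walk (adj G) x y l → Unique l → length l ≤ t
  path-bound w uq = ≤-trans (≤-reflexive (≡.sym size)) (largest (toTree G rooted within) few)
    where open PathTree (path-tree w uq)

  HamiltonCycle : Set
  HamiltonCycle = ∃ λ x → ∃ λ y → ∃ λ l → Walk (adj G) x y l × Unique l × Closes {R = adj G} x y l × (∀ v → v ∈ l)

  Longer : List (Fin n) → Set
  Longer l = ∃ λ x → ∃ λ y → ∃ λ l′ → Walk (adj G) x y l′ × Unique l′ × length l′ ≡ suc (length l)

  -- If a vertex is missed, some outside `u` is adjacent to some `c` on the cycle; the cycle is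
  -- rotated to start at `c`, and `u` is put in front.
  open-cycle : ∀ {x y l} → Walk (adj G) x y l → Unique l → Closes {R = adj G} x y l → HamiltonCycle ⊎ Longer l
  open-cycle {x} {y} {l} w uq cl with any? (λ v → ¬? (Any.any? (v ≟_) l))
  ... | no full = inj₁ (x , y , l , w , uq , cl , λ v → decidable-stable (Any.any? (v ≟_) l) λ v∉ → full (v , v∉))
  ... | yes (v , v∉) with crossing (λ u → does (Any.any? (u ≟_) l)) (proj₂ (connectedOn-linked G-connected refl refl))
                                   (dec-true (Any.any? (x ≟_) l) (start∈ w)) (λ h → v∉ (does⁻ (Any.any? (v ≟_) l) h))
  ...   | c , u , c∈ , u∉ , cu with rotate w cl (does⁻ (Any.any? (c ≟_) l) c∈)
  ...     | a , l′ , w′ , l↭l′ =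
    inj₂ (u , a , u ∷ l′ , trans (sym G u c) cu ◂ w′ ,
          ∉⇒All≢ (λ u∈ → u∉ (dec-true (Any.any? (u ≟_) l) (∈-resp-↭ (↭-sym l↭l′) u∈))) ∷ unique-↭ l↭l′ uq ,
          cong suc (≡.sym (↭-length l↭l′)))

  module _ (σ : ∀ (x y : Fin n) → x ≢ y → adj G x y ≡ false → t + 1 ≤ deg G x + deg G y + 1) where

    Extends : List (Fin n) → Fin n → Fin n → Set
    Extends l x u = adj G u x ≡ true × u ∉ l

    extends? : ∀ l x → Dec (∃ (Extends l x))
    extends? l x = any? λ u → (adj G u x ≟ᵇ true) ×-dec ¬? (Any.any? (u ≟_) l)

    extend : ∀ {x y u l} → Walk (adj G) x y l → Unique l → Extends l x u → Longer l
    extend w uq (ux , u∉) = _ , _ , _ , ux ◂ w , ∉⇒All≢ u∉ ∷ uq , refl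

    neighbours∈ : ∀ {l x} → ¬ ∃ (Extends l x) → ∀ v → adj G x v ≡ true → v ∈ l
    neighbours∈ {l} {x} none v xv =
      decidable-stable (Any.any? (v ≟_) l) λ v∉ → none (v , trans (sym G v x) xv , v∉)

    -- Ore's crossing argument
    close : ∀ {x y l} → Walk (adj G) x y l → Unique l → x ≢ y → adj G y x ≢ true →
            (∀ v → adj G x v ≡ true → v ∈ l) → (∀ v → adj G y v ≡ true → v ∈ l) →
            ∃ λ x′ → ∃ λ y′ → ∃ λ l′ → Walk (adj G) x′ y′ l′ × l ↭ l′ × adj G y′ x′ ≡ true
    close {x} {y} {l} w uq x≢y ¬yx Nx Ny with crossing-step (adj G x) (adj G y) w (irrefl G y)
    -- Run from `x` to `a`, jump to `y`, return backwards to `b`, and close up with the edge from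
    -- `b` to `x`.
    ... | inj₁ (a , b , l₁ , l₂ , w₁ , w₂ , refl , ya , xb) =
      x , b , l₁ ++ reverse l₂ , walk-++ w₁ (trans (sym G a y) ya) (walk-reverse (sym G) w₂) ,
      ++⁺ˡ l₁ (↭-sym (↭-reverse l₂)) , trans (sym G b x) xb
    ... | inj₂ le = contradiction too-many (<-irrefl refl)
      where
      open ≤-Reasoning
      too-many : t < t
      too-many = begin
        suc t                                                  ≡⟨ +-comm 1 t ⟩
        t + 1                                                  ≤⟨ σ x y x≢y (≢true⇒≡false λ xy → ¬yx (trans (sym G y x) xy)) ⟩
        deg G x + deg G y + 1                                  ≡⟨ +-comm _ 1 ⟩
        suc (deg G x + deg G y)                                ≤⟨ s≤s (+-mono-≤ (countTrue≤countList (adj G x) l (λ _ h → h) Nx)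
                                                                                (countTrue≤countList (adj G y) l (λ _ h → h) Ny)) ⟩
        suc (countList (adj G x) l + countList (adj G y) l)    ≤⟨ le ⟩
        indicator (adj G x x) + length l                       ≡⟨ cong (λ b → indicator b + length l) (irrefl G x) ⟩
        length l                                               ≤⟨ path-bound w uq ⟩
        t                                                      ∎

    -- Prolongation is tried at both ends, at the far one by reversal. Failing that, the vertices of
    -- the path carry a cycle, directly or by `close`, and `open-cycle` decides.
    improve : ∀ {x y l} → Walk (adj G) x y l → Unique l → HamiltonCycle ⊎ Longer l
    improve (stop x) uq = open-cycle (stop x) uq (inj₁ refl)
    improve w@(_◂_ {x} {z = y} {l = l₀} _ w₀) uq@(x≢ ∷ _)
      with extends? (x ∷ l₀) x | extends? (reverse (x ∷ l₀)) y | adj G y x ≟ᵇ true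
    ... | yes (u , ext) | _ | _ = inj₂ (extend w uq ext)
    ... | no _ | yes (u , ext) | _ =
      let x′ , y′ , l′ , w′ , uq′ , len = extend (walk-reverse (sym G) w) (unique-↭ (↭-sym (↭-reverse (x ∷ l₀))) uq) ext
      in inj₂ (x′ , y′ , l′ , w′ , uq′ , trans len (cong suc (length-reverse (x ∷ l₀))))
    ... | no _ | no _ | yes yx = open-cycle w uq (inj₂ yx)
    ... | no ¬x | no ¬y | no ¬yx
      with close w uq (All.lookup x≢ (end∈ w₀)) ¬yx (neighbours∈ ¬x)
                 (λ v yv → ∈-resp-↭ (↭-reverse (x ∷ l₀)) (neighbours∈ ¬y v yv))
    ...   | x′ , y′ , l′ , w′ , l↭l′ , y′x′ =
      Sum.map₂ (λ (a , b , l″ , w″ , uq″ , len) → a , b , l″ , w″ , uq″ , trans len (cong suc (≡.sym (↭-length l↭l′))))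
               (open-cycle w′ (unique-↭ l↭l′ uq) (inj₂ y′x′))

    -- Each improvement lengthens the path by one, and no path exceeds `t` vertices, so `fuel`
    -- bounds the number of rounds.
    search : ∀ fuel {x y l} → Walk (adj G) x y l → Unique l → t ≤ fuel + length l → HamiltonCycle
    search fuel w uq le with improve w uq
    ... | inj₁ cycle = cycle
    search zero w uq le | inj₂ (_ , _ , _ , w′ , uq′ , len) =
      contradiction (≤-trans (≤-reflexive (≡.sym len)) (≤-trans (path-bound w′ uq′) le)) (<-irrefl refl)
    search (suc fuel) w uq le | inj₂ (_ , _ , _ , w′ , uq′ , len) =
      search fuel w′ uq′ (≤-trans le (≤-reflexive (trans (≡.sym (+-suc fuel _)) (cong (fuel +_) (≡.sym len)))))

  spanning-cycle : HamiltonCycle → Σ (KEnded G 1) Spanning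
  spanning-cycle (x , y , l , w , uq , cl , all∈) = cyc cycle , λ v → any-true (all∈ v)
    where
    closing : Closes {R = adj G} x y l → 3 ≤ length l →
              ∀ u v → head l ≡ just u → last l ≡ just v → adj G v u ≡ true
    closing (inj₁ refl) (s≤s ())
    closing (inj₂ yx) _ u v hu lv with just-injective (trans (≡.sym (walk-head w)) hu)
                                     | just-injective (trans (≡.sym (walk-last w)) lv)
    ... | refl | refl = yx
    length-positive : ∀ {v : Fin n} {l} → v ∈ l → 1 ≤ length l
    length-positive (here _)  = s≤s z≤n
    length-positive (there _) = s≤s z≤n
    cycle : GCycle G
    cycle = record
      { verts = l ; distinct = uq ; nonempty = length-positive (start∈ w)
      ; chain = walk-chain w ; closed = closing cl }
    any-true : ∀ {v l} → v ∈ l → any (λ u → ⌊ u ≟ v ⌋) l ≡ true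
    any-true {v} (here refl) rewrite isYes≗does (v ≟ v) | dec-true (v ≟ v) refl = refl
    any-true {v} (there {x} v∈) rewrite any-true v∈ = ∨-zeroʳ ⌊ x ≟ v ⌋

-- The cases k = 1 and k ≥ 2

theorem2 : ∀ {m} (G : Graph (suc m)) (k : ℕ) → 1 ≤ k → Connected G →
    ∀ (t : ℕ) → IsT G (suc k) t →
    (∀ (x y : Fin (suc m)) → x ≢ y → adj G x y ≡ false → t + 1 ≤ deg G x + deg G y + k) →
    Σ (KEnded G k) Spanning
theorem2 G (suc zero) _ con t (_ , max) σ =
  -- The search starts from the one-vertex path at `zero`.
  spanning-cycle (search σ t (stop zero) ([] ∷ []) (m≤m+n t 1))
  where open HamiltonCycles G con t (λ T few → max (tree T few))
theorem2 G (suc (suc j)) _ con t ((tree T few , size) , max) σ =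
  let T′ , few′ , all = spanning-tree σ (s≤s (s≤s z≤n)) T few size in tree T′ few′ , all
  where open Largest G con (suc (suc j)) t (s≤s z≤n) (λ T few → max (tree T few))
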